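{- For every real number $a$, every positive integer $m$ and every integer $n\ge 0$, $$\int_{ -1}^{0}\widetilde{F}_{m,a}(n;mx)\,dx=m^nB_n\left(\frac{ -a}{m}\right).$$
   Context: For a real number $a$, a positive integer $m$ and integers $n,k\ge 0$, the noncentral Whitney numbers of the second kind are given by $$\widetilde{W}_{m,a}(n,k)=\frac{1}{m^k k!}\sum_{j=0}^{k}\binom{k}{j}(-1)^{k-j}(mj-a)^n,$$ with the convention $0^0=1$. The noncentral Tanny-Dowling polynomials are $$\widetilde{F}_{m,a}(n;x)=\sum_{k=0}^{n}k!\,\widetilde{W}_{m,a}(n,k)\,x^k.$$ $B_n(t)$ denotes the $n$-th Bernoulli polynomial, defined by $\sum_{n=0}^{\infty}B_n(t)\frac{z^n}{n!}=\frac{z e^{tz}}{e^z-1}$. -}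

module Defs where

open import Algebra.Bundles using (CommutativeRing; Semiring)
import Data.Fin.Base as Fin
open import Data.Fin.Base using (Fin; zero; suc; toℕ; inject₁)
open import Data.Fin.Properties using (toℕ-fromℕ; toℕ-inject₁; toℕ≤pred[n])
import Data.Integer.Base as ℤ
import Data.Integer.Properties as ℤ
open import Data.Nat.Base as ℕ using (ℕ; zero; suc; NonZero; _∸_; _!)
open import Data.Nat.Combinatorics using (_C_)
import Data.Nat.Properties as ℕ
open import Data.Product.Base using (∃; _×_; _,_; proj₁; proj₂)
open import Data.Rational.Base as ℚ using (ℚ; 0ℚ; 1ℚ; ½)
import Data.Rational.Properties as ℚ
import Data.Rational.Unnormalised.Base as ℚᵘ
import Data.Rational.Unnormalised.Properties as ℚᵘ
open import Data.Rational.Solver using (module +-*-Solver)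
open import Data.Sum.Base using (inj₁; inj₂)
open import Data.Vec.Functional using (Vector)
open import Level using (0ℓ)
open import Relation.Binary.PropositionalEquality as ≡ using (_≡_)

private
  open +-*-Solver using (solve; _:=_; _:+_; _:*_; _:-_; con)

  0<½* : ∀ {ε} → 0ℚ ℚ.< ε → 0ℚ ℚ.< ½ ℚ.* ε
  0<½* {ε} 0<ε = ℚ.positive⁻¹ (½ ℚ.* ε)
    {{ℚ.pos*pos⇒pos ½ ε {{ℚ.positive 0<ε}}}}

  ½+½ : ∀ ε → ½ ℚ.* ε ℚ.+ ½ ℚ.* ε ≡ ε
  ½+½ ε = ≡.trans (≡.sym (ℚ.*-distribʳ-+ ε ½ ½)) (ℚ.*-identityˡ ε)

  0<+ : ∀ {p q} → 0ℚ ℚ.< p → 0ℚ ℚ.< q → 0ℚ ℚ.< p ℚ.+ q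
  0<+ {p} {q} 0<p 0<q = ℚ.positive⁻¹ (p ℚ.+ q)
    {{ℚ.pos+pos⇒pos p {{ℚ.positive 0<p}} q {{ℚ.positive 0<q}}}}

  ∣p-p∣≡0 : ∀ p → ℚ.∣ p ℚ.- p ∣ ≡ 0ℚ
  ∣p-p∣≡0 p = ≡.cong ℚ.∣_∣ (ℚ.+-inverseʳ p)

  ∣p-q∣≡∣q-p∣ : ∀ p q → ℚ.∣ p ℚ.- q ∣ ≡ ℚ.∣ q ℚ.- p ∣
  ∣p-q∣≡∣q-p∣ p q = ≡.trans
    (≡.cong ℚ.∣_∣ (solve 2 (λ x y → x :- y := con 0ℚ :- (y :- x)) ≡.refl p q))
    (≡.trans (≡.cong ℚ.∣_∣ (ℚ.+-identityˡ _)) (ℚ.∣-p∣≡∣p∣ (q ℚ.- p)))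

  triangle : ∀ p q r → ℚ.∣ p ℚ.- r ∣ ℚ.≤ ℚ.∣ p ℚ.- q ∣ ℚ.+ ℚ.∣ q ℚ.- r ∣
  triangle p q r = ≡.subst (ℚ._≤ ℚ.∣ p ℚ.- q ∣ ℚ.+ ℚ.∣ q ℚ.- r ∣)
    (≡.cong ℚ.∣_∣
      (solve 3 (λ x y z → (x :- y) :+ (y :- z) := x :- z) ≡.refl p q r))
    (ℚ.∣p+q∣≤∣p∣+∣q∣ (p ℚ.- q) (q ℚ.- r))

  ∣p∣-∣q∣≤∣p-q∣ : ∀ p q → ℚ.∣ p ∣ ℚ.- ℚ.∣ q ∣ ℚ.≤ ℚ.∣ p ℚ.- q ∣
  ∣p∣-∣q∣≤∣p-q∣ p q = ≡.subst (ℚ.∣ p ∣ ℚ.- ℚ.∣ q ∣ ℚ.≤_)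
    (solve 2 (λ x y → x :+ y :- y := x) ≡.refl ℚ.∣ p ℚ.- q ∣ ℚ.∣ q ∣)
    (ℚ.+-monoˡ-≤ (ℚ.- ℚ.∣ q ∣)
      (≡.subst (λ r → ℚ.∣ r ∣ ℚ.≤ ℚ.∣ p ℚ.- q ∣ ℚ.+ ℚ.∣ q ∣)
        (solve 2 (λ x y → x :- y :+ y := x) ≡.refl p q)
        (ℚ.∣p+q∣≤∣p∣+∣q∣ (p ℚ.- q) q)))

  ∣∣p∣-∣q∣∣≤∣p-q∣ : ∀ p q → ℚ.∣ ℚ.∣ p ∣ ℚ.- ℚ.∣ q ∣ ∣ ℚ.≤ ℚ.∣ p ℚ.- q ∣
  ∣∣p∣-∣q∣∣≤∣p-q∣ p q with ℚ.∣p∣≡p∨∣p∣≡-p (ℚ.∣ p ∣ ℚ.- ℚ.∣ q ∣)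
  ... | inj₁ eq = ≡.subst (ℚ._≤ ℚ.∣ p ℚ.- q ∣) (≡.sym eq) (∣p∣-∣q∣≤∣p-q∣ p q)
  ... | inj₂ eq = ≡.subst₂ ℚ._≤_
    (≡.trans
      (solve 2 (λ x y → y :- x := con 0ℚ :- (x :- y)) ≡.refl ℚ.∣ p ∣ ℚ.∣ q ∣)
      (≡.trans (ℚ.+-identityˡ _) (≡.sym eq)))
    (∣p-q∣≡∣q-p∣ q p)
    (∣p∣-∣q∣≤∣p-q∣ q p)

  sum-estimate : ∀ {ε} p q p′ q′ →
    ℚ.∣ p ℚ.- p′ ∣ ℚ.≤ ½ ℚ.* ε → ℚ.∣ q ℚ.- q′ ∣ ℚ.≤ ½ ℚ.* ε →
    ℚ.∣ (p ℚ.+ q) ℚ.- (p′ ℚ.+ q′) ∣ ℚ.≤ ε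
  sum-estimate {ε} p q p′ q′ h k = ≡.subst₂ ℚ._≤_
    (≡.cong ℚ.∣_∣
      (solve 4 (λ x y x′ y′ → (x :- x′) :+ (y :- y′) := (x :+ y) :- (x′ :+ y′))
        ≡.refl p q p′ q′))
    (½+½ ε)
    (ℚ.≤-trans (ℚ.∣p+q∣≤∣p∣+∣q∣ (p ℚ.- p′) (q ℚ.- q′)) (ℚ.+-mono-≤ h k))

  neg-estimate : ∀ p q → ℚ.∣ (ℚ.- p) ℚ.- (ℚ.- q) ∣ ≡ ℚ.∣ p ℚ.- q ∣
  neg-estimate p q = ≡.trans
    (≡.cong ℚ.∣_∣ (≡.sym (ℚ.neg-distrib-+ p (ℚ.- q))))
    (ℚ.∣-p∣≡∣p∣ (p ℚ.- q))

  ∣*∣-mono : ∀ {A B} p q → ℚ.∣ p ∣ ℚ.≤ A → ℚ.∣ q ∣ ℚ.≤ B →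
    ℚ.∣ p ℚ.* q ∣ ℚ.≤ A ℚ.* B
  ∣*∣-mono {A} p q h k = ≡.subst (ℚ._≤ _) (≡.sym (ℚ.∣p*q∣≡∣p∣*∣q∣ p q))
    (ℚ.≤-trans
      (ℚ.*-monoʳ-≤-nonNeg ℚ.∣ q ∣ {{ℚ.∣-∣-nonNeg q}} h)
      (ℚ.*-monoˡ-≤-nonNeg A
        {{ℚ.nonNegative (ℚ.≤-trans (ℚ.0≤∣p∣ p) h)}} k))

  product-estimate : ∀ {A B δ} p q p′ q′ →
    ℚ.∣ p ∣ ℚ.≤ A → ℚ.∣ q′ ∣ ℚ.≤ B →
    ℚ.∣ p ℚ.- p′ ∣ ℚ.≤ δ → ℚ.∣ q ℚ.- q′ ∣ ℚ.≤ δ →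
    ℚ.∣ p ℚ.* q ℚ.- p′ ℚ.* q′ ∣ ℚ.≤ (A ℚ.+ B) ℚ.* δ
  product-estimate {A} {B} {δ} p q p′ q′ hp hq′ hp′ hq = ≡.subst₂ ℚ._≤_
    (≡.cong ℚ.∣_∣
      (solve 4 (λ x y x′ y′ →
          x :* (y :- y′) :+ y′ :* (x :- x′) := x :* y :- x′ :* y′)
        ≡.refl p q p′ q′))
    (≡.sym (ℚ.*-distribʳ-+ δ A B))
    (ℚ.≤-trans
      (ℚ.∣p+q∣≤∣p∣+∣q∣ (p ℚ.* (q ℚ.- q′)) (q′ ℚ.* (p ℚ.- p′)))
      (ℚ.+-mono-≤ (∣*∣-mono p (q ℚ.- q′) hp hq)
                  (∣*∣-mono q′ (p ℚ.- p′) hq′ hp′)))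

  divide : ∀ {A ε} → 0ℚ ℚ.< A → 0ℚ ℚ.< ε → ∃ λ δ → 0ℚ ℚ.< δ × A ℚ.* δ ≡ ε
  divide {A} {ε} 0<A 0<ε =
    (ℚ.1/ A) ℚ.* ε ,
    ℚ.positive⁻¹ _
      {{ℚ.pos*pos⇒pos (ℚ.1/ A) {{ℚ.1/pos⇒pos A}} ε {{ℚ.positive 0<ε}}}} ,
    ≡.trans (≡.sym (ℚ.*-assoc A (ℚ.1/ A) ε))
      (≡.trans (≡.cong (ℚ._* ε) (ℚ.*-inverseʳ A)) (ℚ.*-identityˡ ε))
    where
    instance
      A-pos : ℚ.Positive A
      A-pos = ℚ.positive 0<A
      A-nonZero : ℚ.NonZero A
      A-nonZero = ℚ.pos⇒nonZero A

  ⊔-≤ˡ : ∀ {i} m n → m ℕ.⊔ n ℕ.≤ i → m ℕ.≤ i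
  ⊔-≤ˡ m n = ℕ.≤-trans (ℕ.m≤m⊔n m n)

  ⊔-≤ʳ : ∀ {i} m n → m ℕ.⊔ n ℕ.≤ i → n ℕ.≤ i
  ⊔-≤ʳ m n = ℕ.≤-trans (ℕ.m≤n⊔m m n)

-- Real numbers are Cauchy sequences of rationals carrying an explicit
-- modulus; equality of reals is the setoid relation _≈_.

infix 4 _≈_ _≤_ _<_
infixl 6 _+_ _-_
infixl 7 _*_ _÷_
infix 8 -_

record ℝ : Set where
  no-eta-equality
  constructor mkℝ
  field
    seq    : ℕ → ℚ
    cauchy : ∀ ε → 0ℚ ℚ.< ε → ∃ λ N → ∀ i j → N ℕ.≤ i → N ℕ.≤ j →
             ℚ.∣ seq i ℚ.- seq j ∣ ℚ.≤ ε

open ℝ public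

record _≈_ (x y : ℝ) : Set where
  no-eta-equality
  constructor mk≈
  field
    close : ∀ ε → 0ℚ ℚ.< ε → ∃ λ N → ∀ i → N ℕ.≤ i →
            ℚ.∣ seq x i ℚ.- seq y i ∣ ℚ.≤ ε

open _≈_ public

record _≤_ (x y : ℝ) : Set where
  no-eta-equality
  constructor mk≤
  field
    below : ∀ ε → 0ℚ ℚ.< ε → ∃ λ N → ∀ i → N ℕ.≤ i →
            seq x i ℚ.≤ seq y i ℚ.+ ε

open _≤_ public

record _<_ (x y : ℝ) : Set where
  no-eta-equality
  constructor mk<
  field
    gap   : ℚ
    0<gap : 0ℚ ℚ.< gap
    from  : ℕ
    apart : ∀ i → from ℕ.≤ i → seq x i ℚ.+ gap ℚ.≤ seq y i

open _<_ public

fromℚ : ℚ → ℝ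
fromℚ q .seq _ = q
fromℚ q .cauchy ε 0<ε = 0 , λ _ _ _ _ →
  ≡.subst (ℚ._≤ ε) (≡.sym (∣p-p∣≡0 q)) (ℚ.<⇒≤ 0<ε)

fromℕ : ℕ → ℝ
fromℕ n = fromℚ (ℤ.+ n ℚ./ 1)

0ℝ 1ℝ : ℝ
0ℝ = fromℚ 0ℚ
1ℝ = fromℚ 1ℚ

_+_ : ℝ → ℝ → ℝ
(x + y) .seq i = seq x i ℚ.+ seq y i
(x + y) .cauchy ε 0<ε =
  let M , hx = cauchy x (½ ℚ.* ε) (0<½* 0<ε)
      N , hy = cauchy y (½ ℚ.* ε) (0<½* 0<ε)
  in M ℕ.⊔ N , λ i j i≥ j≥ →
     sum-estimate (seq x i) (seq y i) (seq x j) (seq y j)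
       (hx i j (⊔-≤ˡ M N i≥) (⊔-≤ˡ M N j≥))
       (hy i j (⊔-≤ʳ M N i≥) (⊔-≤ʳ M N j≥))

-_ : ℝ → ℝ
(- x) .seq i = ℚ.- seq x i
(- x) .cauchy ε 0<ε =
  let N , h = cauchy x ε 0<ε
  in N , λ i j i≥ j≥ →
     ≡.subst (ℚ._≤ ε) (≡.sym (neg-estimate (seq x i) (seq x j))) (h i j i≥ j≥)

∣_∣ : ℝ → ℝ
∣ x ∣ .seq i = ℚ.∣ seq x i ∣
∣ x ∣ .cauchy ε 0<ε =
  let N , h = cauchy x ε 0<ε
  in N , λ i j i≥ j≥ →
     ℚ.≤-trans (∣∣p∣-∣q∣∣≤∣p-q∣ (seq x i) (seq x j)) (h i j i≥ j≥)

eventually-bounded : ∀ x → ∃ λ A → 0ℚ ℚ.< A × ∃ λ N → ∀ i → N ℕ.≤ i →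
                     ℚ.∣ seq x i ∣ ℚ.≤ A
eventually-bounded x =
  let N , h = cauchy x 1ℚ (ℚ.positive⁻¹ 1ℚ)
      c = seq x N
  in 1ℚ ℚ.+ ℚ.∣ c ∣ ,
     ℚ.positive⁻¹ _ {{ℚ.pos+nonNeg⇒pos 1ℚ ℚ.∣ c ∣ {{ℚ.∣-∣-nonNeg c}}}} ,
     N , λ i i≥ →
       ≡.subst (λ r → ℚ.∣ r ∣ ℚ.≤ 1ℚ ℚ.+ ℚ.∣ c ∣)
         (solve 2 (λ u v → u :- v :+ v := u) ≡.refl (seq x i) c)
         (ℚ.≤-trans (ℚ.∣p+q∣≤∣p∣+∣q∣ (seq x i ℚ.- c) c)
           (ℚ.+-monoˡ-≤ ℚ.∣ c ∣ (h i N i≥ ℕ.≤-refl)))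

_*_ : ℝ → ℝ → ℝ
(x * y) .seq i = seq x i ℚ.* seq y i
(x * y) .cauchy ε 0<ε =
  let A , 0<A , K , hA = eventually-bounded x
      B , 0<B , L , hB = eventually-bounded y
      δ , 0<δ , eq = divide (0<+ 0<A 0<B) 0<ε
      M , hx = cauchy x δ 0<δ
      N , hy = cauchy y δ 0<δ
  in (K ℕ.⊔ L) ℕ.⊔ (M ℕ.⊔ N) , λ i j i≥ j≥ →
     ≡.subst (_ ℚ.≤_) eq
       (product-estimate (seq x i) (seq y i) (seq x j) (seq y j)
         (hA i (⊔-≤ˡ K L (⊔-≤ˡ (K ℕ.⊔ L) (M ℕ.⊔ N) i≥)))
         (hB j (⊔-≤ʳ K L (⊔-≤ˡ (K ℕ.⊔ L) (M ℕ.⊔ N) j≥)))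
         (hx i j (⊔-≤ˡ M N (⊔-≤ʳ (K ℕ.⊔ L) (M ℕ.⊔ N) i≥))
                 (⊔-≤ˡ M N (⊔-≤ʳ (K ℕ.⊔ L) (M ℕ.⊔ N) j≥)))
         (hy i j (⊔-≤ʳ M N (⊔-≤ʳ (K ℕ.⊔ L) (M ℕ.⊔ N) i≥))
                 (⊔-≤ʳ M N (⊔-≤ʳ (K ℕ.⊔ L) (M ℕ.⊔ N) j≥))))

_-_ : ℝ → ℝ → ℝ
x - y = x + (- y)

_÷_ : ℝ → (n : ℕ) .{{_ : NonZero n}} → ℝ
x ÷ n = x * fromℚ (ℤ.+ 1 ℚ./ n)

pointwise⇒≈ : ∀ {x y} → (∀ i → seq x i ≡ seq y i) → x ≈ y
pointwise⇒≈ {x} {y} h .close ε 0<ε = 0 , λ i _ →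
  ≡.subst (λ q → ℚ.∣ seq x i ℚ.- q ∣ ℚ.≤ ε) (h i)
    (≡.subst (ℚ._≤ ε) (≡.sym (∣p-p∣≡0 (seq x i))) (ℚ.<⇒≤ 0<ε))

private
  ≈-refl : ∀ {x} → x ≈ x
  ≈-refl = pointwise⇒≈ λ _ → ≡.refl

  ≈-sym : ∀ {x y} → x ≈ y → y ≈ x
  ≈-sym {x} {y} x≈y .close ε 0<ε =
    let N , h = close x≈y ε 0<ε
    in N , λ i i≥ →
       ≡.subst (ℚ._≤ ε) (∣p-q∣≡∣q-p∣ (seq x i) (seq y i)) (h i i≥)

  ≈-trans : ∀ {x y z} → x ≈ y → y ≈ z → x ≈ z
  ≈-trans {x} {y} {z} x≈y y≈z .close ε 0<ε =
    let M , h = close x≈y (½ ℚ.* ε) (0<½* 0<ε)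
        N , k = close y≈z (½ ℚ.* ε) (0<½* 0<ε)
    in M ℕ.⊔ N , λ i i≥ →
       ≡.subst (_ ℚ.≤_) (½+½ ε)
         (ℚ.≤-trans (triangle (seq x i) (seq y i) (seq z i))
           (ℚ.+-mono-≤ (h i (⊔-≤ˡ M N i≥)) (k i (⊔-≤ʳ M N i≥))))

  +-cong : ∀ {x x′ y y′} → x ≈ x′ → y ≈ y′ → x + y ≈ x′ + y′
  +-cong {x} {x′} {y} {y′} x≈x′ y≈y′ .close ε 0<ε =
    let M , h = close x≈x′ (½ ℚ.* ε) (0<½* 0<ε)
        N , k = close y≈y′ (½ ℚ.* ε) (0<½* 0<ε)
    in M ℕ.⊔ N , λ i i≥ →
       sum-estimate (seq x i) (seq y i) (seq x′ i) (seq y′ i)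
         (h i (⊔-≤ˡ M N i≥)) (k i (⊔-≤ʳ M N i≥))

  neg-cong : ∀ {x y} → x ≈ y → - x ≈ - y
  neg-cong {x} {y} x≈y .close ε 0<ε =
    let N , h = close x≈y ε 0<ε
    in N , λ i i≥ →
       ≡.subst (ℚ._≤ ε) (≡.sym (neg-estimate (seq x i) (seq y i))) (h i i≥)

  *-cong : ∀ {x x′ y y′} → x ≈ x′ → y ≈ y′ → x * y ≈ x′ * y′
  *-cong {x} {x′} {y} {y′} x≈x′ y≈y′ .close ε 0<ε =
    let A , 0<A , K , hA = eventually-bounded x
        B , 0<B , L , hB = eventually-bounded y′
        δ , 0<δ , eq = divide (0<+ 0<A 0<B) 0<ε
        M , h = close x≈x′ δ 0<δ
        N , k = close y≈y′ δ 0<δ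
    in (K ℕ.⊔ L) ℕ.⊔ (M ℕ.⊔ N) , λ i i≥ →
       let i≥KL = ⊔-≤ˡ (K ℕ.⊔ L) (M ℕ.⊔ N) i≥
           i≥MN = ⊔-≤ʳ (K ℕ.⊔ L) (M ℕ.⊔ N) i≥
       in ≡.subst (_ ℚ.≤_) eq
            (product-estimate (seq x i) (seq y i) (seq x′ i) (seq y′ i)
              (hA i (⊔-≤ˡ K L i≥KL)) (hB i (⊔-≤ʳ K L i≥KL))
              (h i (⊔-≤ˡ M N i≥MN)) (k i (⊔-≤ʳ M N i≥MN)))

ℝ-commutativeRing : CommutativeRing 0ℓ 0ℓ
ℝ-commutativeRing = record
  { Carrier = ℝ
  ; _≈_ = _≈_
  ; _+_ = _+_
  ; _*_ = _*_
  ; -_  = -_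
  ; 0#  = 0ℝ
  ; 1#  = 1ℝ
  ; isCommutativeRing = record
    { isRing = record
      { +-isAbelianGroup = record
        { isGroup = record
          { isMonoid = record
            { isSemigroup = record
              { isMagma = record
                { isEquivalence = record
                  { refl = ≈-refl ; sym = ≈-sym ; trans = ≈-trans }
                ; ∙-cong = +-cong
                }
              ; assoc = λ x y z → pointwise⇒≈ λ i →
                  ℚ.+-assoc (seq x i) (seq y i) (seq z i)
              }
            ; identity =
                (λ x → pointwise⇒≈ λ i → ℚ.+-identityˡ (seq x i)) ,
                (λ x → pointwise⇒≈ λ i → ℚ.+-identityʳ (seq x i))
            }
          ; inverse =
              (λ x → pointwise⇒≈ λ i → ℚ.+-inverseˡ (seq x i)) ,
              (λ x → pointwise⇒≈ λ i → ℚ.+-inverseʳ (seq x i))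
          ; ⁻¹-cong = neg-cong
          }
        ; comm = λ x y → pointwise⇒≈ λ i → ℚ.+-comm (seq x i) (seq y i)
        }
      ; *-cong = *-cong
      ; *-assoc = λ x y z → pointwise⇒≈ λ i →
          ℚ.*-assoc (seq x i) (seq y i) (seq z i)
      ; *-identity =
          (λ x → pointwise⇒≈ λ i → ℚ.*-identityˡ (seq x i)) ,
          (λ x → pointwise⇒≈ λ i → ℚ.*-identityʳ (seq x i))
      ; distrib =
          (λ x y z → pointwise⇒≈ λ i →
            ℚ.*-distribˡ-+ (seq x i) (seq y i) (seq z i)) ,
          (λ x y z → pointwise⇒≈ λ i →
            ℚ.*-distribʳ-+ (seq x i) (seq y i) (seq z i))
      }
    ; *-comm = λ x y → pointwise⇒≈ λ i → ℚ.*-comm (seq x i) (seq y i)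
    }
  }

private
  module R = CommutativeRing ℝ-commutativeRing

open import Algebra.Definitions.RawSemiring (Semiring.rawSemiring R.semiring) public using (_^_)
open import Algebra.Properties.Semiring.Sum R.semiring public
  using (sum; sum-syntax; sum⁺-syntax)
open import Algebra.Properties.Semiring.Sum R.semiring
  using (sum-init-last; sum-cong-≋)

record TaggedPartition (α β : ℝ) : Set where
  field
    size       : ℕ
    node       : Vector ℝ (suc size)
    tag        : Vector ℝ size
    node-first : node zero ≈ α
    node-last  : node (Fin.fromℕ size) ≈ β
    node≤tag   : ∀ i → node (inject₁ i) ≤ tag i
    tag≤node   : ∀ i → tag i ≤ node (suc i)

  width : Vector ℝ size
  width i = node (suc i) - node (inject₁ i)

  riemannSum : (ℝ → ℝ) → ℝ
  riemannSum f = ∑[ i < size ] (f (tag i) * width i)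

-- For α ≤ β: f is Riemann integrable on [α, β] and its integral is I.
HasIntegral : (f : ℝ → ℝ) (α β I : ℝ) → Set
HasIntegral f α β I =
  ∀ ε → 0ℝ < ε → ∃ λ δ → 0ℝ < δ × (∀ (P : TaggedPartition α β) →
    let open TaggedPartition P in
    (∀ i → width i ≤ δ) → ∣ riemannSum f - I ∣ ≤ ε)

-- Generating functions are formal power series in z, given by their
-- coefficients.
Series : Set
Series = ℕ → ℝ

infix 4 _≋_
infix 8 z·_
infixl 6 _⊖_
infixl 7 _⊛_ _⊘_
_≋_ : Series → Series → Set
f ≋ g = ∀ n → f n ≈ g n

one : Series
one zero    = 1ℝ
one (suc _) = 0ℝ

z·_ : Series → Series
(z· f) zero    = 0ℝ
(z· f) (suc n) = f n

_⊖_ : Series → Series → Series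
(f ⊖ g) n = f n - g n

_⊛_ : Series → Series → Series
(f ⊛ g) n = ∑[ i ≤ n ] (f (toℕ i) * g (n ∸ toℕ i))

-- e^{tz}
exp : ℝ → Series
exp t n = ((t ^ n) ÷ (n !)) {{n ℕ.!≢0}}

-- Long division; this is the quotient f / g when g has constant term 1.
_⊘_ : Series → Series → Series
(f ⊘ g) zero    = f 0
(f ⊘ g) (suc n) = ((λ k → f (suc k) - f 0 * g (suc k)) ⊘ g) n

-- z e^{tz} / (e^z - 1) is computed as e^{tz} / ((e^z - 1) / z); the
-- coefficient of z^n in (e^z - 1) / z is that of z^{n+1} in e^z.
-- See bernoulli-egf below.
bernoulliSeries : ℝ → Series
bernoulliSeries t = exp t ⊘ (λ n → exp 1ℝ (suc n))

B : ℕ → ℝ → ℝ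
B n t = fromℕ (n !) * bernoulliSeries t n

W̃ : (m : ℕ) .{{_ : NonZero m}} (a : ℝ) (n k : ℕ) → ℝ
W̃ m a n k =
  ((∑[ j ≤ k ] (fromℕ (k C toℕ j) * (- 1ℝ) ^ (k ∸ toℕ j)
                * (fromℕ m * fromℕ (toℕ j) - a) ^ n))
   ÷ (m ℕ.^ k ℕ.* k !))
  {{ℕ.m*n≢0 (m ℕ.^ k) (k !) {{ℕ.m^n≢0 m k}} {{k ℕ.!≢0}}}}

F̃ : (m : ℕ) .{{_ : NonZero m}} (a : ℝ) (n : ℕ) → ℝ → ℝ
F̃ m a n x = ∑[ k ≤ n ] (fromℕ (toℕ k !) * W̃ m a n (toℕ k) * x ^ toℕ k)

open import Relation.Binary.Reasoning.Setoid R.setoid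

n*1/n≡1 : ∀ n .{{_ : NonZero n}} → (ℤ.+ n ℚ./ 1) ℚ.* (ℤ.+ 1 ℚ./ n) ≡ 1ℚ
n*1/n≡1 n@(suc k) = ℚ.toℚᵘ-injective (ℚᵘ.≃-trans
  (ℚ.toℚᵘ-homo-* (ℤ.+ n ℚ./ 1) (ℤ.+ 1 ℚ./ n))
  (ℚᵘ.≃-trans
    (ℚᵘ.*-cong (ℚ.toℚᵘ-fromℚᵘ (ℚᵘ.mkℚᵘ (ℤ.+ n) 0))
               (ℚ.toℚᵘ-fromℚᵘ (ℚᵘ.mkℚᵘ (ℤ.+ 1) k)))
    (ℚᵘ.*≡* (≡.cong ℤ.+_ (ℕ-eq n)))))
  where
  ℕ-eq : ∀ n → n ℕ.* 1 ℕ.* 1 ≡ 1 ℕ.* (1 ℕ.* n)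
  ℕ-eq n = ≡.trans (ℕ.*-identityʳ (n ℕ.* 1))
    (≡.trans (ℕ.*-comm n 1) (≡.sym (ℕ.*-identityˡ (1 ℕ.* n))))

n*x÷n≈x : ∀ n .{{_ : NonZero n}} x → (fromℕ n * x) ÷ n ≈ x
n*x÷n≈x n x = begin
  fromℕ n * x * n⁻¹     ≈⟨ R.*-congʳ (R.*-comm (fromℕ n) x) ⟩
  x * fromℕ n * n⁻¹     ≈⟨ R.*-assoc x (fromℕ n) n⁻¹ ⟩
  x * (fromℕ n * n⁻¹)   ≈⟨ R.*-congˡ (pointwise⇒≈ λ _ → n*1/n≡1 n) ⟩
  x * 1ℝ                 ≈⟨ R.*-identityʳ x ⟩
  x                      ∎
  where n⁻¹ = fromℚ (ℤ.+ 1 ℚ./ n)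

⊘-⊛ : ∀ f g → g 0 ≈ 1ℝ → (f ⊘ g) ⊛ g ≋ f
⊘-⊛ f g g₀≈1 zero = begin
  f 0 * g 0 + 0ℝ  ≈⟨ R.+-identityʳ (f 0 * g 0) ⟩
  f 0 * g 0       ≈⟨ R.*-congˡ g₀≈1 ⟩
  f 0 * 1ℝ        ≈⟨ R.*-identityʳ (f 0) ⟩
  f 0             ∎
⊘-⊛ f g g₀≈1 (suc n) = begin
  c + ((f′ ⊘ g) ⊛ g) n   ≈⟨ R.+-congˡ (⊘-⊛ f′ g g₀≈1 n) ⟩
  c + (f (suc n) - c)    ≈⟨ R.+-comm c (f (suc n) - c) ⟩
  f (suc n) - c + c      ≈⟨ R.+-assoc (f (suc n)) (- c) c ⟩
  f (suc n) + (- c + c)  ≈⟨ R.+-congˡ (R.-‿inverseˡ c) ⟩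
  f (suc n) + 0ℝ         ≈⟨ R.+-identityʳ (f (suc n)) ⟩
  f (suc n)              ∎
  where
  c  = f 0 * g (suc n)
  f′ : Series
  f′ k = f (suc k) - f 0 * g (suc k)

⊛-z· : ∀ f g h → h 0 ≈ 0ℝ → (∀ n → h (suc n) ≈ g n) → f ⊛ h ≋ (z· (f ⊛ g))
⊛-z· f g h h₀≈0 hₛ≈g zero = begin
  f 0 * h 0 + 0ℝ  ≈⟨ R.+-identityʳ (f 0 * h 0) ⟩
  f 0 * h 0       ≈⟨ R.*-congˡ h₀≈0 ⟩
  f 0 * 0ℝ        ≈⟨ R.zeroʳ (f 0) ⟩
  0ℝ              ∎
⊛-z· f g h h₀≈0 hₛ≈g (suc n) = begin
  (f ⊛ h) (suc n)
    ≈⟨ sum-init-last terms ⟩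
  sum (λ i → terms (inject₁ i)) + terms (Fin.fromℕ (suc n))
    ≈⟨ R.+-cong (sum-cong-≋ init≈) last≈ ⟩
  (f ⊛ g) n + 0ℝ
    ≈⟨ R.+-identityʳ ((f ⊛ g) n) ⟩
  (f ⊛ g) n ∎
  where
  terms : Vector ℝ (suc (suc n))
  terms i = f (toℕ i) * h (suc n ∸ toℕ i)

  init≈ : ∀ (i : Fin (suc n)) → terms (inject₁ i) ≈ f (toℕ i) * g (n ∸ toℕ i)
  init≈ i rewrite toℕ-inject₁ i | ℕ.+-∸-assoc 1 (toℕ≤pred[n] i) =
    R.*-congˡ (hₛ≈g (n ∸ toℕ i))

  last≈ : terms (Fin.fromℕ (suc n)) ≈ 0ℝ
  last≈ rewrite toℕ-fromℕ n | ℕ.n∸n≡0 n =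
    R.trans (R.*-congˡ h₀≈0) (R.zeroʳ (f (suc n)))

-- (Σ Bₙ(t) zⁿ/n!) (e^z - 1) = z e^{tz}
bernoulli-egf : ∀ t →
  (λ n → (B n t ÷ (n !)) {{n ℕ.!≢0}}) ⊛ (exp 1ℝ ⊖ one) ≋ (z· exp t)
bernoulli-egf t n = begin
  (b ⊛ (exp 1ℝ ⊖ one)) n
    ≈⟨ sum-cong-≋ {suc n} (λ i → R.*-congʳ {(exp 1ℝ ⊖ one) (n ∸ toℕ i)}
         (n*x÷n≈x (toℕ i !) {{toℕ i ℕ.!≢0}} (bernoulliSeries t (toℕ i)))) ⟩
  (bernoulliSeries t ⊛ (exp 1ℝ ⊖ one)) n
    ≈⟨ ⊛-z· (bernoulliSeries t) g (exp 1ℝ ⊖ one) h₀≈0 hₛ≈g n ⟩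
  (z· (bernoulliSeries t ⊛ g)) n
    ≈⟨ shift n ⟩
  (z· exp t) n ∎
  where
  b g : Series
  b n = (B n t ÷ (n !)) {{n ℕ.!≢0}}
  g n = exp 1ℝ (suc n)

  g₀≈1 : g 0 ≈ 1ℝ
  g₀≈1 = pointwise⇒≈ λ _ → ≡.refl

  h₀≈0 : exp 1ℝ 0 - 1ℝ ≈ 0ℝ
  h₀≈0 = pointwise⇒≈ λ _ → ≡.refl

  hₛ≈g : ∀ n → exp 1ℝ (suc n) - 0ℝ ≈ g n
  hₛ≈g n = pointwise⇒≈ λ i → ℚ.+-identityʳ (seq (g n) i)

  shift : (z· (bernoulliSeries t ⊛ g)) ≋ (z· exp t)
  shift zero    = R.refl
  shift (suc n) = ⊘-⊛ (exp t) g g₀≈1 n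

{-# OPTIONS --safe #-}

-- Put t = -a/m. Since k! m^k W̃(n,k) = mⁿ Δ^k xⁿ at x = t and ∫ x^k over [-1,0]
-- is (-1)^k/(k+1), the integral is mⁿ times Λ xⁿ at t, where Λ = log(1+Δ)/Δ.
-- The product rule for Δ^k shows that ΛΔ = log(1+Δ) is a derivation, hence that
-- ΛΔ xⁿ⁺¹ = (n+1) xⁿ. Expanding Δ xⁿ⁺¹ by the binomial theorem turns this into
-- (Σ Λxⁱ zⁱ/i!) (e^z - 1)/z = e^{tz}, which characterises the Bernoulli polynomials.
module Submission where

open import Algebra.Bundles using (CommutativeRing)
open import Algebra.Definitions.RawMonoid using () renaming (_×_ to multiple)
import Algebra.Properties.CommutativeSemiring.Binomial as Binomial
import Algebra.Properties.CommutativeSemiring.Exp as Exp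
import Algebra.Properties.Semiring.Sum as Sum
import Algebra.Solver.Ring
open import Algebra.Solver.Ring.AlmostCommutativeRing
  using (AlmostCommutativeRing; fromCommutativeRing; _-Raw-AlmostCommutative⟶_)
open import Data.Fin.Base as Fin using (zero; suc; toℕ; inject₁)
open import Data.Integer.Base as ℤ using (ℤ)
import Data.Integer.Properties as ℤ
open import Data.Maybe.Base using (just; nothing)
open import Data.Nat.Base as ℕ using (ℕ; zero; suc; NonZero; _∸_; _!)
open import Data.Nat.Combinatorics using (_C_; nCk+nC[k+1]≡[n+1]C[k+1];
  nCk≡n!/k![n-k]!; k![n∸k]!∣n!; nCn≡1; k>n⇒nCk≡0)
open import Data.Nat.DivMod using (m/n*n≡m)
import Data.Nat.Properties as ℕ
open import Data.Product.Base using (∃; _×_; _,_)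
open import Data.Rational.Base as ℚ using (ℚ; 0ℚ; 1ℚ; ½)
import Data.Rational.Properties as ℚ
import Data.Rational.Solver as ℚ
import Data.Rational.Unnormalised.Base as ℚᵘ
import Data.Rational.Unnormalised.Properties as ℚᵘ
open import Data.Sum.Base using (inj₁; inj₂)
open import Data.Vec.Functional using (Vector)
open import Defs
open import Level using (0ℓ)
open import Relation.Binary.Bundles using (Preorder)
open import Relation.Binary.Definitions using (WeaklyDecidable)
open import Relation.Binary.PropositionalEquality as ≡ using (_≡_)
import Relation.Binary.Reasoning.Preorder as PreorderReasoning
import Relation.Binary.Reasoning.Setoid as SetoidReasoning
open import Relation.Nullary.Decidable using (yes; no)

-- Two obstacles shape the proof. The integral ranges over all tagged partitions of constructive
-- reals, whose signs cannot be decided; so integrability comes from algebraic error estimates for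
-- powers, and sign distinctions are made only on rational approximants. And log(1+Δ)/Δ is an
-- infinite series, so it is truncated at an order N; since Δ^k kills xⁿ for k > n, every N > n
-- gives the same value on xⁿ. The derivation property comes from a cancellation. If y grows by 1 at
-- each step, then Δ^(k+1)(y h) = y Δ^(k+1) h + (k+1)(1+Δ)Δ^k h. The weight (-1)^k/(k+1) cancels
-- k+1, and the sum of (-1)^k (1+Δ)Δ^k h over k < N telescopes to h - (-1)^N Δ^N h, whose last term
-- vanishes when h is a polynomial of degree below N.

module R = CommutativeRing ℝ-commutativeRing
module ^ = Exp R.commutativeSemiring

-- Integers inside the reals, and a ring solver with integer coefficients.

fromℤ : ℤ → ℝ
fromℤ z = fromℚ (z ℚ./ 1)

fromℚᵘ-homo-+ : ∀ p q → ℚ.fromℚᵘ (p ℚᵘ.+ q) ≡ ℚ.fromℚᵘ p ℚ.+ ℚ.fromℚᵘ q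
fromℚᵘ-homo-+ p q = ℚ.toℚᵘ-injective (ℚᵘ.≃-trans (ℚ.toℚᵘ-fromℚᵘ (p ℚᵘ.+ q))
  (ℚᵘ.≃-sym (ℚᵘ.≃-trans (ℚ.toℚᵘ-homo-+ (ℚ.fromℚᵘ p) (ℚ.fromℚᵘ q))
    (ℚᵘ.+-cong (ℚ.toℚᵘ-fromℚᵘ p) (ℚ.toℚᵘ-fromℚᵘ q)))))

fromℚᵘ-homo-* : ∀ p q → ℚ.fromℚᵘ (p ℚᵘ.* q) ≡ ℚ.fromℚᵘ p ℚ.* ℚ.fromℚᵘ q
fromℚᵘ-homo-* p q = ℚ.toℚᵘ-injective (ℚᵘ.≃-trans (ℚ.toℚᵘ-fromℚᵘ (p ℚᵘ.* q))
  (ℚᵘ.≃-sym (ℚᵘ.≃-trans (ℚ.toℚᵘ-homo-* (ℚ.fromℚᵘ p) (ℚ.fromℚᵘ q))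
    (ℚᵘ.*-cong (ℚ.toℚᵘ-fromℚᵘ p) (ℚ.toℚᵘ-fromℚᵘ q)))))

fromℤ-homo-+ : ∀ x y → fromℤ (x ℤ.+ y) ≈ fromℤ x + fromℤ y
fromℤ-homo-+ x y = pointwise⇒≈ λ _ → ≡.trans
  -- Unnormalised addition over the denominators 1 has numerator `x * 1 + y * 1`.
  (≡.cong (ℚ._/ 1) (≡.sym (≡.cong₂ ℤ._+_ (ℤ.*-identityʳ x) (ℤ.*-identityʳ y))))
  (fromℚᵘ-homo-+ (ℚᵘ.mkℚᵘ x 0) (ℚᵘ.mkℚᵘ y 0))

fromℤ-homo-* : ∀ x y → fromℤ (x ℤ.* y) ≈ fromℤ x * fromℤ y
fromℤ-homo-* x y = pointwise⇒≈ λ _ → fromℚᵘ-homo-* (ℚᵘ.mkℚᵘ x 0) (ℚᵘ.mkℚᵘ y 0)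

fromℤ-homo-- : ∀ x → fromℤ (ℤ.- x) ≈ - fromℤ x
fromℤ-homo-- x = pointwise⇒≈ λ _ → ℚ.toℚᵘ-injective
  (ℚᵘ.≃-trans (ℚ.toℚᵘ-fromℚᵘ (ℚᵘ.mkℚᵘ (ℤ.- x) 0))
    (ℚᵘ.≃-sym (ℚᵘ.≃-trans (ℚ.toℚᵘ-homo‿- (ℚ.fromℚᵘ (ℚᵘ.mkℚᵘ x 0)))
      (ℚᵘ.-‿cong (ℚ.toℚᵘ-fromℚᵘ (ℚᵘ.mkℚᵘ x 0))))))

private
  ℝ-acr : AlmostCommutativeRing 0ℓ 0ℓ
  ℝ-acr = fromCommutativeRing ℝ-commutativeRing

  fromℤ-morphism : ℤ.+-*-rawRing -Raw-AlmostCommutative⟶ ℝ-acr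
  fromℤ-morphism = record
    { ⟦_⟧ = fromℤ
    ; +-homo = fromℤ-homo-+
    ; *-homo = fromℤ-homo-*
    ; -‿homo = fromℤ-homo--
    ; 0-homo = R.refl
    ; 1-homo = R.refl
    }

  -- Equality of reals is undecidable; comparing the integers themselves is what lets the solver
  -- cancel coefficients.
  fromℤ-≟ : WeaklyDecidable (λ x y → fromℤ x ≈ fromℤ y)
  fromℤ-≟ x y with x ℤ.≟ y
  ... | yes x≡y = just (R.reflexive (≡.cong fromℤ x≡y))
  ... | no _    = nothing

module ℝ-Solver = Algebra.Solver.Ring ℤ.+-*-rawRing ℝ-acr fromℤ-morphism fromℤ-≟

-- Order and absolute value on the reals.

module _ where
  open ℚ.+-*-Solver

  q+[p-q]≡p : ∀ p q → q ℚ.+ (p ℚ.- q) ≡ p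
  q+[p-q]≡p = solve 2 (λ p q → q :+ (p :- q) := p) ≡.refl

  p+q-p≡q : ∀ p q → p ℚ.+ q ℚ.- p ≡ q
  p+q-p≡q = solve 2 (λ p q → p :+ q :- p := q) ≡.refl

  ½p+½p≡p : ∀ p → ½ ℚ.* p ℚ.+ ½ ℚ.* p ≡ p
  ½p+½p≡p = solve 1 (λ p → con ½ :* p :+ con ½ :* p := p) ≡.refl

  p+½ε+½ε≡p+ε : ∀ p ε → p ℚ.+ ½ ℚ.* ε ℚ.+ ½ ℚ.* ε ≡ p ℚ.+ ε
  p+½ε+½ε≡p+ε = solve 2 (λ p ε → p :+ con ½ :* ε :+ con ½ :* ε := p :+ ε) ≡.refl

  [p+½ε]+[q+½ε]≡p+q+ε : ∀ p q ε →
    (p ℚ.+ ½ ℚ.* ε) ℚ.+ (q ℚ.+ ½ ℚ.* ε) ≡ p ℚ.+ q ℚ.+ ε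
  [p+½ε]+[q+½ε]≡p+q+ε =
    solve 3 (λ p q ε → (p :+ con ½ :* ε) :+ (q :+ con ½ :* ε) := p :+ q :+ ε) ≡.refl

open ℝ-Solver using (solve; _:=_; _:+_; _:*_; _:-_; :-_; con)

p≤∣p∣ : ∀ p → p ℚ.≤ ℚ.∣ p ∣
p≤∣p∣ p with ℚ.≤-total 0ℚ p
... | inj₁ 0≤p = ℚ.≤-reflexive (≡.sym (ℚ.0≤p⇒∣p∣≡p 0≤p))
... | inj₂ p≤0 = ℚ.≤-trans p≤0 (ℚ.0≤∣p∣ p)

p≤q+∣p-q∣ : ∀ p q → p ℚ.≤ q ℚ.+ ℚ.∣ p ℚ.- q ∣
p≤q+∣p-q∣ p q = ≡.subst (ℚ._≤ q ℚ.+ ℚ.∣ p ℚ.- q ∣)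
  (q+[p-q]≡p p q)
  (ℚ.+-monoʳ-≤ q (p≤∣p∣ (p ℚ.- q)))

∣p∣≤∣q∣+∣p-q∣ : ∀ p q → ℚ.∣ p ∣ ℚ.≤ ℚ.∣ q ∣ ℚ.+ ℚ.∣ p ℚ.- q ∣
∣p∣≤∣q∣+∣p-q∣ p q = ≡.subst (λ r → ℚ.∣ r ∣ ℚ.≤ ℚ.∣ q ∣ ℚ.+ ℚ.∣ p ℚ.- q ∣)
  (q+[p-q]≡p p q)
  (ℚ.∣p+q∣≤∣p∣+∣q∣ q (p ℚ.- q))

p≤p+nonNeg : ∀ p {ε} → 0ℚ ℚ.≤ ε → p ℚ.≤ p ℚ.+ ε
p≤p+nonNeg p {ε} 0≤ε = ≡.subst (ℚ._≤ p ℚ.+ ε) (ℚ.+-identityʳ p) (ℚ.+-monoʳ-≤ p 0≤ε)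

0<½ε : ∀ {ε} → 0ℚ ℚ.< ε → 0ℚ ℚ.< ½ ℚ.* ε
0<½ε {ε} 0<ε = ℚ.positive⁻¹ (½ ℚ.* ε)
  {{ℚ.pos*pos⇒pos ½ ε {{ℚ.positive 0<ε}}}}

pointwise⇒≤ : ∀ {x y} → (∀ i → seq x i ℚ.≤ seq y i) → x ≤ y
pointwise⇒≤ {x} {y} x≤y .below ε 0<ε = 0 , λ i _ →
  ℚ.≤-trans (x≤y i) (p≤p+nonNeg (seq y i) (ℚ.<⇒≤ 0<ε))

≤-reflexive : ∀ {x y} → x ≈ y → x ≤ y
≤-reflexive {x} {y} x≈y .below ε 0<ε =
  let N , h = close x≈y ε 0<ε
  in N , λ i i≥ → ℚ.≤-trans (p≤q+∣p-q∣ (seq x i) (seq y i))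
       (ℚ.+-monoʳ-≤ (seq y i) (h i i≥))

≤-trans : ∀ {x y z} → x ≤ y → y ≤ z → x ≤ z
≤-trans {x} {y} {z} x≤y y≤z .below ε 0<ε =
  let M , h = below x≤y (½ ℚ.* ε) (0<½ε 0<ε)
      N , k = below y≤z (½ ℚ.* ε) (0<½ε 0<ε)
  in M ℕ.⊔ N , λ i i≥ → ≡.subst (seq x i ℚ.≤_)
       (p+½ε+½ε≡p+ε (seq z i) ε)
       (ℚ.≤-trans (h i (ℕ.≤-trans (ℕ.m≤m⊔n M N) i≥))
         (ℚ.+-monoˡ-≤ (½ ℚ.* ε) (k i (ℕ.≤-trans (ℕ.m≤n⊔m M N) i≥))))

≤-preorder : Preorder 0ℓ 0ℓ 0ℓ
≤-preorder = record
  { _≈_ = _≈_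
  ; _≲_ = _≤_
  ; isPreorder = record
    { isEquivalence = R.isEquivalence
    ; reflexive = ≤-reflexive
    ; trans = ≤-trans
    }
  }

module ≤-Reasoning = PreorderReasoning ≤-preorder

≤-refl : ∀ {x} → x ≤ x
≤-refl = ≤-reflexive R.refl

+-mono-≤ : ∀ {x x′ y y′} → x ≤ x′ → y ≤ y′ → x + y ≤ x′ + y′
+-mono-≤ {x} {x′} {y} {y′} x≤x′ y≤y′ .below ε 0<ε =
  let M , h = below x≤x′ (½ ℚ.* ε) (0<½ε 0<ε)
      N , k = below y≤y′ (½ ℚ.* ε) (0<½ε 0<ε)
  in M ℕ.⊔ N , λ i i≥ → ≡.subst (_ ℚ.≤_)
       ([p+½ε]+[q+½ε]≡p+q+ε (seq x′ i) (seq y′ i) ε)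
       (ℚ.+-mono-≤ (h i (ℕ.≤-trans (ℕ.m≤m⊔n M N) i≥))
                   (k i (ℕ.≤-trans (ℕ.m≤n⊔m M N) i≥)))

x≤y⇒0≤y-x : ∀ {x y} → x ≤ y → 0ℝ ≤ y - x
x≤y⇒0≤y-x {x} {y} x≤y = begin
  0ℝ     ≈⟨ R.-‿inverseʳ x ⟨
  x - x  ≲⟨ +-mono-≤ x≤y ≤-refl ⟩
  y - x  ∎
  where open ≤-Reasoning

0≤∣x∣ : ∀ x → 0ℝ ≤ ∣ x ∣
0≤∣x∣ x = pointwise⇒≤ λ i → ℚ.0≤∣p∣ (seq x i)

-- The hypothesis only keeps the terms of `x` eventually above `- ½ ε`, so an approximant `p` may be
-- negative. In that case `∣ p ∣ - p` is bounded by `- p + - p`, hence by `ε`.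
0≤x⇒∣x∣≈x : ∀ {x} → 0ℝ ≤ x → ∣ x ∣ ≈ x
0≤x⇒∣x∣≈x {x} 0≤x .close ε 0<ε =
  let N , h = below 0≤x (½ ℚ.* ε) (0<½ε 0<ε)
  in N , λ i i≥ → estimate (seq x i) (h i i≥)
  where
  estimate : ∀ p → 0ℚ ℚ.≤ p ℚ.+ ½ ℚ.* ε → ℚ.∣ ℚ.∣ p ∣ ℚ.- p ∣ ℚ.≤ ε
  estimate p 0≤p+½ε with ℚ.∣p∣≡p∨∣p∣≡-p p
  ... | inj₁ ∣p∣≡p rewrite ∣p∣≡p | ℚ.+-inverseʳ p = ℚ.<⇒≤ 0<ε
  ... | inj₂ ∣p∣≡-p = ℚ.≤-trans (ℚ.∣p-q∣≤∣p∣+∣q∣ ℚ.∣ p ∣ p)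
    (≡.subst₂ ℚ._≤_ lhs (½p+½p≡p ε)
      (ℚ.+-mono-≤ -p≤½ε -p≤½ε))
    where
    lhs : ℚ.- p ℚ.+ ℚ.- p ≡ ℚ.∣ ℚ.∣ p ∣ ∣ ℚ.+ ℚ.∣ p ∣
    lhs rewrite ℚ.∣∣p∣∣≡∣p∣ p | ∣p∣≡-p = ≡.refl

    -p≤½ε : ℚ.- p ℚ.≤ ½ ℚ.* ε
    -p≤½ε = ≡.subst₂ ℚ._≤_ (ℚ.+-identityˡ (ℚ.- p))
      (p+q-p≡q p (½ ℚ.* ε))
      (ℚ.+-monoˡ-≤ (ℚ.- p) 0≤p+½ε)

∣∣-lub : ∀ {x y} → x ≤ y → - x ≤ y → ∣ x ∣ ≤ y
∣∣-lub {x} {y} x≤y -x≤y .below ε 0<ε =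
  let M , h = below x≤y ε 0<ε
      N , k = below -x≤y ε 0<ε
  in M ℕ.⊔ N , λ i i≥ → cases (seq x i)
       (h i (ℕ.≤-trans (ℕ.m≤m⊔n M N) i≥)) (k i (ℕ.≤-trans (ℕ.m≤n⊔m M N) i≥))
  where
  cases : ∀ p {q} → p ℚ.≤ q → ℚ.- p ℚ.≤ q → ℚ.∣ p ∣ ℚ.≤ q
  cases p p≤q -p≤q with ℚ.∣p∣≡p∨∣p∣≡-p p
  ... | inj₁ eq = ≡.subst (ℚ._≤ _) (≡.sym eq) p≤q
  ... | inj₂ eq = ≡.subst (ℚ._≤ _) (≡.sym eq) -p≤q

∣∣-cong : ∀ {x y} → x ≈ y → ∣ x ∣ ≤ ∣ y ∣
∣∣-cong {x} {y} x≈y .below ε 0<ε =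
  let N , h = close x≈y ε 0<ε
  in N , λ i i≥ → ℚ.≤-trans (∣p∣≤∣q∣+∣p-q∣ (seq x i) (seq y i))
       (ℚ.+-monoʳ-≤ ℚ.∣ seq y i ∣ (h i i≥))

∣x+y∣≤∣x∣+∣y∣ : ∀ x y → ∣ x + y ∣ ≤ ∣ x ∣ + ∣ y ∣
∣x+y∣≤∣x∣+∣y∣ x y = pointwise⇒≤ λ i → ℚ.∣p+q∣≤∣p∣+∣q∣ (seq x i) (seq y i)

∣x*y∣≈∣x∣*∣y∣ : ∀ x y → ∣ x * y ∣ ≈ ∣ x ∣ * ∣ y ∣
∣x*y∣≈∣x∣*∣y∣ x y = pointwise⇒≈ λ i → ℚ.∣p*q∣≡∣p∣*∣q∣ (seq x i) (seq y i)

-- Reading the sign off `∣ x * y ∣` avoids a separate estimate for products of approximants that may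
-- be slightly negative.
0≤x*y : ∀ {x y} → 0ℝ ≤ x → 0ℝ ≤ y → 0ℝ ≤ x * y
0≤x*y {x} {y} 0≤x 0≤y = begin
  0ℝ             ≲⟨ 0≤∣x∣ (x * y) ⟩
  ∣ x * y ∣      ≈⟨ ∣x*y∣≈∣x∣*∣y∣ x y ⟩
  ∣ x ∣ * ∣ y ∣  ≈⟨ R.*-cong (0≤x⇒∣x∣≈x 0≤x) (0≤x⇒∣x∣≈x 0≤y) ⟩
  x * y          ∎
  where open ≤-Reasoning

*-monoʳ-≤ : ∀ {x y z} → 0ℝ ≤ z → x ≤ y → z * x ≤ z * y
*-monoʳ-≤ {x} {y} {z} 0≤z x≤y = begin
  z * x                ≈⟨ R.+-identityʳ (z * x) ⟨
  z * x + 0ℝ           ≲⟨ +-mono-≤ ≤-refl (0≤x*y 0≤z (x≤y⇒0≤y-x x≤y)) ⟩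
  z * x + z * (y - x)  ≈⟨ solve 3 (λ x y z → z :* x :+ z :* (y :- x) := z :* y) R.refl x y z ⟩
  z * y                ∎
  where open ≤-Reasoning

*-monoˡ-≤ : ∀ {x y z} → 0ℝ ≤ z → x ≤ y → x * z ≤ y * z
*-monoˡ-≤ {x} {y} {z} 0≤z x≤y = begin
  x * z  ≈⟨ R.*-comm x z ⟩
  z * x  ≲⟨ *-monoʳ-≤ 0≤z x≤y ⟩
  z * y  ≈⟨ R.*-comm z y ⟩
  y * z  ∎
  where open ≤-Reasoning

∣∣-*-mono : ∀ {x y a b} → ∣ x ∣ ≤ a → ∣ y ∣ ≤ b → ∣ x * y ∣ ≤ a * b
∣∣-*-mono {x} {y} {a} {b} ∣x∣≤a ∣y∣≤b = begin
  ∣ x * y ∣      ≈⟨ ∣x*y∣≈∣x∣*∣y∣ x y ⟩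
  ∣ x ∣ * ∣ y ∣  ≲⟨ *-monoˡ-≤ (0≤∣x∣ y) ∣x∣≤a ⟩
  a * ∣ y ∣      ≲⟨ *-monoʳ-≤ (≤-trans (0≤∣x∣ x) ∣x∣≤a) ∣y∣≤b ⟩
  a * b          ∎
  where open ≤-Reasoning

∣∣-+-mono : ∀ {x y a b} → ∣ x ∣ ≤ a → ∣ y ∣ ≤ b → ∣ x + y ∣ ≤ a + b
∣∣-+-mono {x} {y} ∣x∣≤a ∣y∣≤b = ≤-trans (∣x+y∣≤∣x∣+∣y∣ x y) (+-mono-≤ ∣x∣≤a ∣y∣≤b)

∣∣≤-resp : ∀ {x y a b} → x ≈ y → a ≈ b → ∣ y ∣ ≤ a → ∣ x ∣ ≤ b
∣∣≤-resp x≈y a≈b ∣y∣≤a = ≤-trans (∣∣-cong x≈y) (≤-trans ∣y∣≤a (≤-reflexive a≈b))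

-- The gap that witnesses strict positivity is the required rational. With a rational tolerance, the
-- mesh of a partition can be found by rational division.
0<ε⇒ℚ≤ε : ∀ {ε} → 0ℝ < ε → ∃ λ q → 0ℚ ℚ.< q × fromℚ q ≤ ε
0<ε⇒ℚ≤ε {ε} 0<ε = gap 0<ε , 0<gap 0<ε , q≤ε
  where
  q≤ε : fromℚ (gap 0<ε) ≤ ε
  q≤ε .below η 0<η = from 0<ε , λ i i≥ →
    ℚ.≤-trans (≡.subst (ℚ._≤ seq ε i) (ℚ.+-identityˡ (gap 0<ε)) (apart 0<ε i i≥))
      (p≤p+nonNeg (seq ε i) (ℚ.<⇒≤ 0<η))

fromℚ-positive : ∀ {q} → 0ℚ ℚ.< q → 0ℝ < fromℚ q
fromℚ-positive {q} 0<q = mk< q 0<q 0 λ _ _ → ℚ.≤-reflexive (ℚ.+-identityˡ q)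

≤-fromℚ : ∀ x → ∃ λ A → 0ℚ ℚ.< A × x ≤ fromℚ A
≤-fromℚ x =
  let A , 0<A , N , h = eventually-bounded x
  in A , 0<A , mk≤ λ ε 0<ε → N , λ i i≥ →
       ℚ.≤-trans (p≤∣p∣ (seq x i)) (ℚ.≤-trans (h i i≥) (p≤p+nonNeg A (ℚ.<⇒≤ 0<ε)))

-- Antiderivatives and the Riemann integral over [-1,0].

-- The error is quadratic in the width of the interval, so that the errors over
-- a partition of mesh δ add up to O(δ).
record IsAntiderivative (F f : ℝ → ℝ) : Set where
  field
    F-cong   : ∀ {x y} → x ≈ y → F x ≈ F y
    bound    : ℝ
    estimate : ∀ {u c v} → - 1ℝ ≤ u → u ≤ c → c ≤ v → v ≤ 0ℝ →
               ∣ f c * (v - u) - (F v - F u) ∣ ≤ bound * ((v - u) * (v - u))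

open IsAntiderivative

first≤node : ∀ {n} (node : Vector ℝ (suc n)) →
  (∀ i → node (inject₁ i) ≤ node (suc i)) → ∀ i → node zero ≤ node i
first≤node node step zero = ≤-refl
first≤node {suc n} node step (suc i) =
  ≤-trans (step zero) (first≤node (λ j → node (suc j)) (λ j → step (suc j)) i)

node≤last : ∀ {n} (node : Vector ℝ (suc n)) →
  (∀ i → node (inject₁ i) ≤ node (suc i)) → ∀ i → node i ≤ node (Fin.fromℕ n)
node≤last {zero} node step zero = ≤-refl
node≤last {suc n} node step zero =
  ≤-trans (step zero) (node≤last (λ j → node (suc j)) (λ j → step (suc j)) zero)
node≤last {suc n} node step (suc i) =
  node≤last (λ j → node (suc j)) (λ j → step (suc j)) i

-- The increments of `F` and the widths telescope alike, so by the triangle inequality the local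
-- errors add up to `q` times the total length.
telescope-estimate : ∀ {n} (node : Vector ℝ (suc n)) (g : Vector ℝ n) (F : ℝ → ℝ) q →
  (∀ i → ∣ g i - (F (node (suc i)) - F (node (inject₁ i))) ∣
           ≤ q * (node (suc i) - node (inject₁ i))) →
  ∣ sum g - (F (node (Fin.fromℕ n)) - F (node zero)) ∣
    ≤ q * (node (Fin.fromℕ n) - node zero)
telescope-estimate {zero} node g F q h = ∣∣≤-resp
  (solve 1 (λ y → con ℤ.0ℤ :- (y :- y) := con ℤ.0ℤ) R.refl (F (node zero)))
  (solve 2 (λ q x → con ℤ.0ℤ := q :* (x :- x)) R.refl q (node zero))
  (≤-reflexive (0≤x⇒∣x∣≈x ≤-refl))
telescope-estimate {suc n} node g F q h = ∣∣≤-resp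
  (solve 5 (λ g s a b c → (g :+ s) :- (c :- a) := (g :- (b :- a)) :+ (s :- (c :- b))) R.refl
    (g zero) (sum λ j → g (suc j))
    (F (node zero)) (F (node (suc zero))) (F (node (Fin.fromℕ (suc n)))))
  (solve 4 (λ q a b c → q :* (b :- a) :+ q :* (c :- b) := q :* (c :- a)) R.refl
    q (node zero) (node (suc zero)) (node (Fin.fromℕ (suc n))))
  (∣∣-+-mono (h zero)
    (telescope-estimate (λ j → node (suc j)) (λ j → g (suc j)) F q (λ j → h (suc j))))

module _ {F f I} (F′≈f : IsAntiderivative F f) (F≈I : F 0ℝ - F (- 1ℝ) ≈ I)
  {A q} (0<A : 0ℚ ℚ.< A) (0<q : 0ℚ ℚ.< q) (K≤A : bound F′≈f ≤ fromℚ A) where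

  private
    instance
      A-pos : ℚ.Positive A
      A-pos = ℚ.positive 0<A
      A-nonZero : ℚ.NonZero A
      A-nonZero = ℚ.pos⇒nonZero A

  -- Chosen so that a cell of width `w` at most `mesh` has error at most `A * (w * w)`, which is at
  -- most `q * w`. As the interval has length 1, the total error is at most `q`.
  mesh : ℚ
  mesh = (ℚ.1/ A) ℚ.* q

  0<mesh : 0ℚ ℚ.< mesh
  0<mesh = ℚ.positive⁻¹ mesh {{ℚ.pos*pos⇒pos (ℚ.1/ A) {{ℚ.1/pos⇒pos A}} q {{ℚ.positive 0<q}}}}

  A*mesh≡q : A ℚ.* mesh ≡ q
  A*mesh≡q = ≡.trans (≡.sym (ℚ.*-assoc A (ℚ.1/ A) q))
    (≡.trans (≡.cong (ℚ._* q) (ℚ.*-inverseʳ A)) (ℚ.*-identityˡ q))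

  riemannSum-close : ∀ (P : TaggedPartition (- 1ℝ) 0ℝ) → let open TaggedPartition P in
    (∀ i → width i ≤ fromℚ mesh) → ∣ riemannSum f - I ∣ ≤ fromℚ q
  riemannSum-close P w≤mesh = ∣∣≤-resp
      -- The end nodes are only `≈` to `- 1ℝ` and `0ℝ`, and a function on representatives need not
      -- respect `≈`; `F-cong` is what moves `F` from one to the other.
      (R.+-congˡ (R.-‿cong (R.trans (R.sym F≈I)
        (R.+-cong (F-cong F′≈f (R.sym node-last)) (R.-‿cong (F-cong F′≈f (R.sym node-first)))))))
      (R.trans (R.*-congˡ (R.+-cong node-last (R.-‿cong node-first)))
        (solve 1 (λ q → q :* (con ℤ.0ℤ :- (:- con ℤ.1ℤ)) := q) R.refl (fromℚ q)))
      (telescope-estimate node (λ i → f (tag i) * width i) F (fromℚ q) local)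
    where
    open TaggedPartition P

    step : ∀ i → node (inject₁ i) ≤ node (suc i)
    step i = ≤-trans (node≤tag i) (tag≤node i)

    local : ∀ i → ∣ f (tag i) * width i - (F (node (suc i)) - F (node (inject₁ i))) ∣
                    ≤ fromℚ q * width i
    local i = begin
      ∣ f (tag i) * w - (F (node (suc i)) - F (node (inject₁ i))) ∣
        ≲⟨ estimate F′≈f
             (≤-trans (≤-reflexive (R.sym node-first)) (first≤node node step (inject₁ i)))
             (node≤tag i) (tag≤node i)
             (≤-trans (node≤last node step (suc i)) (≤-reflexive node-last)) ⟩
      bound F′≈f * (w * w)     ≲⟨ *-monoˡ-≤ (0≤x*y 0≤w 0≤w) K≤A ⟩
      fromℚ A * (w * w)        ≲⟨ *-monoʳ-≤ 0≤A (*-monoˡ-≤ 0≤w (w≤mesh i)) ⟩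
      fromℚ A * (fromℚ mesh * w)  ≈⟨ R.*-assoc (fromℚ A) (fromℚ mesh) w ⟨
      fromℚ A * fromℚ mesh * w    ≈⟨ R.*-congʳ (pointwise⇒≈ λ _ → A*mesh≡q) ⟩
      fromℚ q * w              ∎
      where
      open ≤-Reasoning

      w : ℝ
      w = width i

      0≤w : 0ℝ ≤ w
      0≤w = x≤y⇒0≤y-x (step i)

      0≤A : 0ℝ ≤ fromℚ A
      0≤A = pointwise⇒≤ λ _ → ℚ.<⇒≤ 0<A

antiderivative⇒integral : ∀ {F f I} → IsAntiderivative F f →
  F 0ℝ - F (- 1ℝ) ≈ I → HasIntegral f (- 1ℝ) 0ℝ I
antiderivative⇒integral F′≈f F≈I ε 0<ε =
  let q , 0<q , q≤ε = 0<ε⇒ℚ≤ε 0<ε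
      A , 0<A , K≤A = ≤-fromℚ (bound F′≈f)
  in fromℚ (mesh F′≈f F≈I 0<A 0<q K≤A) , fromℚ-positive (0<mesh F′≈f F≈I 0<A 0<q K≤A) ,
     λ P w≤δ → ≤-trans (riemannSum-close F′≈f F≈I 0<A 0<q K≤A P w≤δ) q≤ε

antiderivative-resp : ∀ {F f g} → (∀ x → g x ≈ f x) → IsAntiderivative F f → IsAntiderivative F g
antiderivative-resp g≈f F′≈f .F-cong = F-cong F′≈f
antiderivative-resp g≈f F′≈f .bound = bound F′≈f
antiderivative-resp g≈f F′≈f .estimate {c = c} -1≤u u≤c c≤v v≤0 =
  ∣∣≤-resp (R.+-congʳ (R.*-congʳ (g≈f c))) R.refl (estimate F′≈f -1≤u u≤c c≤v v≤0)

antiderivative-0 : IsAntiderivative (λ _ → 0ℝ) (λ _ → 0ℝ)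
antiderivative-0 .F-cong _ = R.refl
antiderivative-0 .bound = 0ℝ
antiderivative-0 .estimate {u} {c} {v} _ _ _ _ = ∣∣≤-resp
  (solve 1 (λ w → con ℤ.0ℤ :* w :- (con ℤ.0ℤ :- con ℤ.0ℤ) := con ℤ.0ℤ) R.refl (v - u))
  (R.sym (R.zeroˡ ((v - u) * (v - u))))
  (≤-reflexive (0≤x⇒∣x∣≈x ≤-refl))

antiderivative-+ : ∀ {F G f g} → IsAntiderivative F f → IsAntiderivative G g →
  IsAntiderivative (λ x → F x + G x) (λ x → f x + g x)
antiderivative-+ F′≈f G′≈g .F-cong x≈y = R.+-cong (F-cong F′≈f x≈y) (F-cong G′≈g x≈y)
antiderivative-+ F′≈f G′≈g .bound = bound F′≈f + bound G′≈g
antiderivative-+ {F} {G} {f} {g} F′≈f G′≈g .estimate {u} {c} {v} -1≤u u≤c c≤v v≤0 = ∣∣≤-resp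
  (solve 7
    (λ f g w a b a′ b′ → (f :+ g) :* w :- ((a :+ b) :- (a′ :+ b′))
      := (f :* w :- (a :- a′)) :+ (g :* w :- (b :- b′))) R.refl
    (f c) (g c) (v - u) (F v) (G v) (F u) (G u))
  (R.sym (R.distribʳ ((v - u) * (v - u)) (bound F′≈f) (bound G′≈g)))
  (∣∣-+-mono (estimate F′≈f -1≤u u≤c c≤v v≤0) (estimate G′≈g -1≤u u≤c c≤v v≤0))

antiderivative-* : ∀ {F f} a → IsAntiderivative F f →
  IsAntiderivative (λ x → a * F x) (λ x → a * f x)
antiderivative-* a F′≈f .F-cong x≈y = R.*-congˡ (F-cong F′≈f x≈y)
antiderivative-* a F′≈f .bound = ∣ a ∣ * bound F′≈f
antiderivative-* {F} {f} a F′≈f .estimate {u} {c} {v} -1≤u u≤c c≤v v≤0 = ∣∣≤-resp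
  (solve 5 (λ a f w F F′ → a :* f :* w :- (a :* F :- a :* F′) := a :* (f :* w :- (F :- F′)))
    R.refl a (f c) (v - u) (F v) (F u))
  (R.sym (R.*-assoc ∣ a ∣ (bound F′≈f) ((v - u) * (v - u))))
  (∣∣-*-mono {a} ≤-refl (estimate F′≈f -1≤u u≤c c≤v v≤0))

-- Powers and their derivatives on [-1,0].

fromℕ-suc : ∀ n → fromℕ (suc n) ≈ 1ℝ + fromℕ n
fromℕ-suc n = fromℤ-homo-+ (ℤ.+ 1) (ℤ.+ n)

fromℕ-* : ∀ m n → fromℕ (m ℕ.* n) ≈ fromℕ m * fromℕ n
fromℕ-* m n = R.trans (R.reflexive (≡.cong fromℤ (ℤ.pos-* m n))) (fromℤ-homo-* (ℤ.+ m) (ℤ.+ n))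

neg-antimono-≤ : ∀ {x y} → x ≤ y → - y ≤ - x
neg-antimono-≤ {x} {y} x≤y = begin
  - y              ≈⟨ solve 2 (λ x y → :- y := x :+ (:- x :- y)) R.refl x y ⟩
  x + (- x - y)    ≲⟨ +-mono-≤ x≤y ≤-refl ⟩
  y + (- x - y)    ≈⟨ solve 2 (λ x y → y :+ (:- x :- y) := :- x) R.refl x y ⟩
  - x              ∎
  where open ≤-Reasoning

-1≤x≤0⇒∣x∣≤1 : ∀ {x} → - 1ℝ ≤ x → x ≤ 0ℝ → ∣ x ∣ ≤ 1ℝ
-1≤x≤0⇒∣x∣≤1 {x} -1≤x x≤0 = ∣∣-lub
  (≤-trans x≤0 (pointwise⇒≤ λ _ → ℚ.<⇒≤ (ℚ.positive⁻¹ 1ℚ)))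
  (≤-trans (neg-antimono-≤ -1≤x)
    (≤-reflexive (solve 0 (:- (:- con ℤ.1ℤ) := con ℤ.1ℤ) R.refl)))

∣x^n∣≤1 : ∀ {x} → ∣ x ∣ ≤ 1ℝ → ∀ n → ∣ x ^ n ∣ ≤ 1ℝ
∣x^n∣≤1 ∣x∣≤1 zero = pointwise⇒≤ λ _ → ℚ.≤-refl
∣x^n∣≤1 ∣x∣≤1 (suc n) =
  ∣∣≤-resp R.refl (R.*-identityˡ 1ℝ) (∣∣-*-mono ∣x∣≤1 (∣x^n∣≤1 ∣x∣≤1 n))

-- Peeling off one factor, `x * p - y * q` equals `x * (p - q) + (x - y) * q`. All powers are
-- bounded by 1, so each of the `n` factors contributes at most `w`.
^-lipschitz : ∀ {x y w} → ∣ x ∣ ≤ 1ℝ → ∣ y ∣ ≤ 1ℝ → ∣ x - y ∣ ≤ w →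
  ∀ n → ∣ x ^ n - y ^ n ∣ ≤ fromℕ n * w
^-lipschitz {w = w} _ _ _ zero = ∣∣≤-resp
  (R.-‿inverseʳ 1ℝ) (R.sym (R.zeroˡ w)) (≤-reflexive (0≤x⇒∣x∣≈x ≤-refl))
^-lipschitz {x} {y} {w} ∣x∣≤1 ∣y∣≤1 ∣x-y∣≤w (suc n) = ∣∣≤-resp
  (solve 4 (λ x y p q → x :* p :- y :* q := x :* (p :- q) :+ (x :- y) :* q)
    R.refl x y (x ^ n) (y ^ n))
  (R.trans
    (solve 2 (λ n w → con ℤ.1ℤ :* (n :* w) :+ w :* con ℤ.1ℤ := (con ℤ.1ℤ :+ n) :* w)
      R.refl (fromℕ n) w)
    (R.*-congʳ (R.sym (fromℕ-suc n))))
  (∣∣-+-mono (∣∣-*-mono ∣x∣≤1 (^-lipschitz ∣x∣≤1 ∣y∣≤1 ∣x-y∣≤w n))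
             (∣∣-*-mono ∣x-y∣≤w (∣x^n∣≤1 ∣y∣≤1 n)))

-- In closed form n(n+1). The two equal summands are the Lipschitz constants of the power `suc n`,
-- one for each cross term in `^-estimate`.
^-estimate-bound : ℕ → ℝ
^-estimate-bound zero    = 0ℝ
^-estimate-bound (suc n) = ^-estimate-bound n + (fromℕ (suc n) + fromℕ (suc n))

-- This replaces the mean value theorem. Raising the exponent multiplies the previous error by `c`
-- and adds `(c - v) * (vⁿ⁺¹ - uⁿ⁺¹) + (cⁿ⁺¹ - uⁿ⁺¹) * (v - u)`; in both products each factor is of
-- order `w`.
^-estimate : ∀ {u c v w} → ∣ u ∣ ≤ 1ℝ → ∣ c ∣ ≤ 1ℝ → ∣ v ∣ ≤ 1ℝ →
  ∣ c - v ∣ ≤ w → ∣ v - u ∣ ≤ w → ∣ c - u ∣ ≤ w → ∀ n →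
  ∣ fromℕ (suc n) * c ^ n * (v - u) - (v ^ suc n - u ^ suc n) ∣
    ≤ ^-estimate-bound n * (w * w)
^-estimate {u} {c} {v} {w} _ _ _ _ _ _ zero = ∣∣≤-resp
  (solve 2 (λ u v → con ℤ.1ℤ :* con ℤ.1ℤ :* (v :- u) :- (v :* con ℤ.1ℤ :- u :* con ℤ.1ℤ)
      := con ℤ.0ℤ) R.refl u v)
  (R.sym (R.zeroˡ (w * w)))
  (≤-reflexive (0≤x⇒∣x∣≈x ≤-refl))
^-estimate {u} {c} {v} {w} ∣u∣≤1 ∣c∣≤1 ∣v∣≤1 ∣c-v∣≤w ∣v-u∣≤w ∣c-u∣≤w (suc n) = ∣∣≤-resp
  (R.trans (R.+-congʳ (R.*-congʳ (R.*-congʳ (fromℕ-suc (suc n)))))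
    (solve 7 (λ u c v n cⁿ uⁿ⁺¹ vⁿ⁺¹ →
        (con ℤ.1ℤ :+ n) :* (c :* cⁿ) :* (v :- u) :- (v :* vⁿ⁺¹ :- u :* uⁿ⁺¹)
        := c :* (n :* cⁿ :* (v :- u) :- (vⁿ⁺¹ :- uⁿ⁺¹))
           :+ ((c :- v) :* (vⁿ⁺¹ :- uⁿ⁺¹) :+ (c :* cⁿ :- uⁿ⁺¹) :* (v :- u)))
      R.refl u c v (fromℕ (suc n)) (c ^ n) (u ^ suc n) (v ^ suc n)))
  (solve 3 (λ K n w →
      con ℤ.1ℤ :* (K :* (w :* w)) :+ (w :* (n :* w) :+ n :* w :* w)
      := (K :+ (n :+ n)) :* (w :* w))
    R.refl (^-estimate-bound n) (fromℕ (suc n)) w)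
  (∣∣-+-mono
    (∣∣-*-mono ∣c∣≤1 (^-estimate ∣u∣≤1 ∣c∣≤1 ∣v∣≤1 ∣c-v∣≤w ∣v-u∣≤w ∣c-u∣≤w n))
    (∣∣-+-mono
      (∣∣-*-mono ∣c-v∣≤w (^-lipschitz ∣v∣≤1 ∣u∣≤1 ∣v-u∣≤w (suc n)))
      (∣∣-*-mono (^-lipschitz ∣c∣≤1 ∣u∣≤1 ∣c-u∣≤w (suc n)) ∣v-u∣≤w)))

antiderivative-^ : ∀ n → IsAntiderivative (λ x → x ^ suc n) (λ x → fromℕ (suc n) * x ^ n)
antiderivative-^ n .F-cong = ^.^-congˡ (suc n)
antiderivative-^ n .bound = ^-estimate-bound n
antiderivative-^ n .estimate {u} {c} {v} -1≤u u≤c c≤v v≤0 = ^-estimate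
  (-1≤x≤0⇒∣x∣≤1 -1≤u (≤-trans u≤v v≤0))
  (-1≤x≤0⇒∣x∣≤1 (≤-trans -1≤u u≤c) (≤-trans c≤v v≤0))
  (-1≤x≤0⇒∣x∣≤1 (≤-trans -1≤u u≤v) v≤0)
  (∣∣-lub (≤-trans (+-mono-≤ c≤v ≤-refl) (≤-trans (≤-reflexive (R.-‿inverseʳ v)) (x≤y⇒0≤y-x u≤v)))
    (≤-trans (≤-reflexive (solve 2 (λ c v → :- (c :- v) := v :- c) R.refl c v))
      (+-mono-≤ ≤-refl (neg-antimono-≤ u≤c))))
  (≤-reflexive (0≤x⇒∣x∣≈x (x≤y⇒0≤y-x u≤v)))
  (≤-trans (≤-reflexive (0≤x⇒∣x∣≈x (x≤y⇒0≤y-x u≤c))) (+-mono-≤ c≤v ≤-refl))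
  n
  where
  u≤v : u ≤ v
  u≤v = ≤-trans u≤c c≤v

open SetoidReasoning R.setoid

-- Reciprocals and finite sums.

1/ : ∀ n .{{_ : NonZero n}} → ℝ
1/ n = fromℚ (ℤ.+ 1 ℚ./ n)

n*1/n≈1 : ∀ n .{{_ : NonZero n}} → fromℕ n * 1/ n ≈ 1ℝ
n*1/n≈1 n = pointwise⇒≈ λ _ → n*1/n≡1 n

1/-unique : ∀ n .{{_ : NonZero n}} {x} → fromℕ n * x ≈ 1ℝ → x ≈ 1/ n
1/-unique n {x} n*x≈1 = begin
  x                       ≈⟨ R.*-identityʳ x ⟨
  x * 1ℝ                  ≈⟨ R.*-congˡ (n*1/n≈1 n) ⟨
  x * (fromℕ n * 1/ n)    ≈⟨ solve 3 (λ x n i → x :* (n :* i) := n :* x :* i) R.refl x (fromℕ n) (1/ n) ⟩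
  fromℕ n * x * 1/ n      ≈⟨ R.*-congʳ n*x≈1 ⟩
  1ℝ * 1/ n               ≈⟨ R.*-identityˡ (1/ n) ⟩
  1/ n                    ∎

1/-* : ∀ m n .{{_ : NonZero m}} .{{_ : NonZero n}} .{{_ : NonZero (m ℕ.* n)}} →
  1/ m * 1/ n ≈ 1/ (m ℕ.* n)
1/-* m n = 1/-unique (m ℕ.* n) (begin
  fromℕ (m ℕ.* n) * (1/ m * 1/ n)          ≈⟨ R.*-congʳ (fromℕ-* m n) ⟩
  fromℕ m * fromℕ n * (1/ m * 1/ n)        ≈⟨ solve 4 (λ a b c d → a :* b :* (c :* d) := a :* c :* (b :* d))
                                                R.refl (fromℕ m) (fromℕ n) (1/ m) (1/ n) ⟩
  fromℕ m * 1/ m * (fromℕ n * 1/ n)        ≈⟨ R.*-cong (n*1/n≈1 m) (n*1/n≈1 n) ⟩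
  1ℝ * 1ℝ                                  ≈⟨ R.*-identityˡ 1ℝ ⟩
  1ℝ                                       ∎)

-- Indexing by naturals lets a sum be truncated or extended freely, and splitting off the last term
-- makes raising the truncation order of `Λ` an induction step.
S : ℕ → (ℕ → ℝ) → ℝ
S zero    f = 0ℝ
S (suc N) f = S N f + f N

S-cong : ∀ N {f g : ℕ → ℝ} → (∀ k → k ℕ.< N → f k ≈ g k) → S N f ≈ S N g
S-cong zero    f≈g = R.refl
S-cong (suc N) f≈g = R.+-cong (S-cong N λ k k<N → f≈g k (ℕ.m<n⇒m<1+n k<N)) (f≈g N (ℕ.n<1+n N))

S-+ : ∀ N (f g : ℕ → ℝ) → S N (λ k → f k + g k) ≈ S N f + S N g
S-+ zero    f g = R.sym (R.+-identityˡ 0ℝ)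
S-+ (suc N) f g = begin
  S N (λ k → f k + g k) + (f N + g N)  ≈⟨ R.+-congʳ (S-+ N f g) ⟩
  S N f + S N g + (f N + g N)          ≈⟨ solve 4 (λ a b c d → a :+ b :+ (c :+ d) := a :+ c :+ (b :+ d))
                                            R.refl (S N f) (S N g) (f N) (g N) ⟩
  S N f + f N + (S N g + g N)          ∎

S-* : ∀ N a (f : ℕ → ℝ) → S N (λ k → a * f k) ≈ a * S N f
S-* zero    a f = R.sym (R.zeroʳ a)
S-* (suc N) a f = R.trans (R.+-congʳ (S-* N a f)) (R.sym (R.distribˡ a (S N f) (f N)))

S-front : ∀ N (f : ℕ → ℝ) → S (suc N) f ≈ f 0 + S N (λ k → f (suc k))
S-front zero    f = R.+-comm 0ℝ (f 0)
S-front (suc N) f = R.trans (R.+-congʳ (S-front N f))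
  (R.+-assoc (f 0) (S N λ k → f (suc k)) (f (suc N)))

sum≈S : ∀ N (f : ℕ → ℝ) → ∑[ i < N ] f (toℕ i) ≈ S N f
sum≈S zero    f = R.refl
sum≈S (suc N) f = R.trans (R.+-congˡ (sum≈S N λ k → f (suc k))) (R.sym (S-front N f))

S-truncate : ∀ {M N} {f : ℕ → ℝ} → M ℕ.≤ N → (∀ k → M ℕ.≤ k → f k ≈ 0ℝ) → S N f ≈ S M f
S-truncate {N = zero} ℕ.z≤n f≈0 = R.refl
S-truncate {N = suc N} {f} M≤1+N f≈0 with ℕ.m≤n⇒m<n∨m≡n M≤1+N
... | inj₂ ≡.refl = R.refl
... | inj₁ (ℕ.s≤s M≤N) =
  R.trans (R.+-cong (S-truncate M≤N f≈0) (f≈0 N M≤N)) (R.+-identityʳ _)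

-- Integrals of polynomials over [-1,0].

antiderivative-S : ∀ {F f : ℕ → ℝ → ℝ} (a : ℕ → ℝ) N → (∀ k → IsAntiderivative (F k) (f k)) →
  IsAntiderivative (λ x → S N (λ k → a k * F k x)) (λ x → S N (λ k → a k * f k x))
antiderivative-S a zero    F′≈f = antiderivative-0
antiderivative-S a (suc N) F′≈f =
  antiderivative-+ (antiderivative-S a N F′≈f) (antiderivative-* (a N) (F′≈f N))

monomial : ∀ n → IsAntiderivative (λ x → 1/ (suc n) * x ^ suc n) (_^ n)
monomial n = antiderivative-resp
  (λ x → begin
    x ^ n                              ≈⟨ R.*-identityˡ (x ^ n) ⟨
    1ℝ * x ^ n                         ≈⟨ R.*-congʳ (n*1/n≈1 (suc n)) ⟨
    fromℕ (suc n) * 1/ (suc n) * x ^ n ≈⟨ solve 3 (λ a b c → a :* b :* c := b :* (a :* c))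
                                            R.refl (fromℕ (suc n)) (1/ (suc n)) (x ^ n) ⟩
    1/ (suc n) * (fromℕ (suc n) * x ^ n) ∎)
  (antiderivative-* (1/ (suc n)) (antiderivative-^ n))

-- The coefficients of log(1+Δ)/Δ, and also the integrals of x^k over [-1,0].
weight : ℕ → ℝ
weight k = (- 1ℝ) ^ k * 1/ (suc k)

∫-polynomial : ∀ (a : ℕ → ℝ) N → HasIntegral (λ x → S N (λ k → a k * x ^ k)) (- 1ℝ) 0ℝ
  (S N (λ k → a k * weight k))
∫-polynomial a N = antiderivative⇒integral (antiderivative-S a N monomial) (value N)
  where
  F : ℕ → ℝ → ℝ
  F N x = S N (λ k → a k * (1/ (suc k) * x ^ suc k))

  value : ∀ N → F N 0ℝ - F N (- 1ℝ) ≈ S N (λ k → a k * weight k)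
  value zero    = R.-‿inverseʳ 0ℝ
  value (suc N) = R.trans
    -- The new term vanishes at the upper limit. At the lower limit the minus sign of the difference
    -- cancels one factor of `(- 1ℝ) ^ suc N`, which leaves `weight N`.
    (solve 6 (λ p q a i z s →
        (p :+ a :* (i :* (con ℤ.0ℤ :* z))) :- (q :+ a :* (i :* ((:- con ℤ.1ℤ) :* s)))
        := (p :- q) :+ a :* (s :* i))
      R.refl (F N 0ℝ) (F N (- 1ℝ)) (a N) (1/ (suc N)) (0ℝ ^ N) ((- 1ℝ) ^ N))
    (R.+-congʳ (value N))

-- Finite differences.

Δ : (ℕ → ℝ) → ℕ → ℝ
Δ h j = h (suc j) - h j

Δ^ : ℕ → (ℕ → ℝ) → ℕ → ℝ
Δ^ zero    h = h
Δ^ (suc k) h = Δ (Δ^ k h)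

record IsLinear (Φ : (ℕ → ℝ) → ℝ) : Set where
  field
    cong   : ∀ {g h} → (∀ j → g j ≈ h j) → Φ g ≈ Φ h
    +-homo : ∀ g h → Φ (λ j → g j + h j) ≈ Φ g + Φ h
    *-homo : ∀ a h → Φ (λ j → a * h j) ≈ a * Φ h

  S-homo : ∀ N (a : ℕ → ℝ) (h : ℕ → ℕ → ℝ) →
    Φ (λ j → S N (λ i → a i * h i j)) ≈ S N (λ i → a i * Φ (h i))
  S-homo zero a h = begin
    Φ (λ _ → 0ℝ)         ≈⟨ cong (λ _ → R.zeroˡ 0ℝ) ⟨
    Φ (λ _ → 0ℝ * 0ℝ)    ≈⟨ *-homo 0ℝ (λ _ → 0ℝ) ⟩
    0ℝ * Φ (λ _ → 0ℝ)    ≈⟨ R.zeroˡ _ ⟩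
    0ℝ                   ∎
  S-homo (suc N) a h = R.trans (+-homo _ _) (R.+-cong (S-homo N a h) (*-homo (a N) (h N)))

open IsLinear

Δ^-isLinear : ∀ k j → IsLinear (λ h → Δ^ k h j)
Δ^-isLinear zero    j = record
  { cong = λ g≈h → g≈h j ; +-homo = λ _ _ → R.refl ; *-homo = λ _ _ → R.refl }
Δ^-isLinear (suc k) j = record
  { cong = λ g≈h → R.+-cong (cong (Δ^-isLinear k (suc j)) g≈h)
                            (R.-‿cong (cong (Δ^-isLinear k j) g≈h))
  ; +-homo = λ g h → R.trans
      (R.+-cong (+-homo (Δ^-isLinear k (suc j)) g h) (R.-‿cong (+-homo (Δ^-isLinear k j) g h)))
      (solve 4 (λ a b c d → (a :+ b) :- (c :+ d) := (a :- c) :+ (b :- d)) R.refl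
        (Δ^ k g (suc j)) (Δ^ k h (suc j)) (Δ^ k g j) (Δ^ k h j))
  ; *-homo = λ a h → R.trans
      (R.+-cong (*-homo (Δ^-isLinear k (suc j)) a h) (R.-‿cong (*-homo (Δ^-isLinear k j) a h)))
      (solve 3 (λ a b c → a :* b :- a :* c := a :* (b :- c)) R.refl a (Δ^ k h (suc j)) (Δ^ k h j))
  }

Δ^-shift : ∀ k h j → Δ^ k (λ i → h (suc i)) j ≡ Δ^ k h (suc j)
Δ^-shift zero    h j = ≡.refl
Δ^-shift (suc k) h j = ≡.cong₂ _-_ (Δ^-shift k h (suc j)) (Δ^-shift k h j)

Δ^-Δ : ∀ k h j → Δ^ k (Δ h) j ≡ Δ^ (suc k) h j
Δ^-Δ zero    h j = ≡.refl
Δ^-Δ (suc k) h j = ≡.cong₂ _-_ (Δ^-Δ k h (suc j)) (Δ^-Δ k h j)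

-- The coefficient of E^j in (E - 1)^k, where E = 1 + Δ is the shift. For `j` above `k` the
-- truncated exponent is harmless because the binomial coefficient is 0.
signedC : ℕ → ℕ → ℝ
signedC k j = fromℕ (k C j) * (- 1ℝ) ^ (k ∸ j)

signedC-vanishes : ∀ {k j} → k ℕ.< j → signedC k j ≈ 0ℝ
signedC-vanishes k<j rewrite k>n⇒nCk≡0 k<j = R.zeroˡ _

-- Multiplication by E - 1. Below `k` the exponent `k ∸ j` exceeds `k ∸ suc j` by one, which
-- supplies the sign; at `j = k` truncated subtraction breaks this, but there the second coefficient
-- vanishes.
signedC-pascal : ∀ k j → j ℕ.≤ k → signedC (suc k) (suc j) ≈ signedC k j - signedC k (suc j)
signedC-pascal k j j≤k with ℕ.m≤n⇒m<n∨m≡n j≤k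
... | inj₁ j<k = begin
  fromℕ (suc k C suc j) * (- 1ℝ) ^ (k ∸ j)
    ≡⟨ ≡.cong₂ (λ c e → fromℕ c * (- 1ℝ) ^ e) (≡.sym (nCk+nC[k+1]≡[n+1]C[k+1] k j)) k∸j ⟩
  fromℕ (k C j ℕ.+ k C suc j) * (- 1ℝ * s)
    ≈⟨ R.*-congʳ (fromℤ-homo-+ (ℤ.+ (k C j)) (ℤ.+ (k C suc j))) ⟩
  (fromℕ (k C j) + fromℕ (k C suc j)) * (- 1ℝ * s)
    ≈⟨ solve 3 (λ a b s → (a :+ b) :* (:- con ℤ.1ℤ :* s) := a :* (:- con ℤ.1ℤ :* s) :- b :* s)
         R.refl (fromℕ (k C j)) (fromℕ (k C suc j)) s ⟩
  fromℕ (k C j) * (- 1ℝ * s) - signedC k (suc j)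
    ≡⟨ ≡.cong (λ e → fromℕ (k C j) * (- 1ℝ) ^ e - signedC k (suc j)) k∸j ⟨
  signedC k j - signedC k (suc j) ∎
  where
  s : ℝ
  s = (- 1ℝ) ^ (k ∸ suc j)

  k∸j : k ∸ j ≡ suc (k ∸ suc j)
  k∸j = ℕ.+-∸-assoc 1 j<k
... | inj₂ ≡.refl = begin
  fromℕ (suc k C suc k) * (- 1ℝ) ^ (k ∸ k)
    ≡⟨ ≡.cong (λ c → fromℕ c * (- 1ℝ) ^ (k ∸ k)) (≡.trans (nCn≡1 (suc k)) (≡.sym (nCn≡1 k))) ⟩
  signedC k k                        ≈⟨ solve 1 (λ x → x :- con ℤ.0ℤ := x) R.refl (signedC k k) ⟨
  signedC k k - 0ℝ                   ≈⟨ R.+-congˡ (R.-‿cong (signedC-vanishes (ℕ.n<1+n k))) ⟨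
  signedC k k - signedC k (suc k)    ∎

-- Expands Δ^k = (E - 1)^k. Pascal's rule splits the sum into one for the shifted sequence and one
-- for `h` itself; the separated front term supplies the missing `j = 0` of the latter, and its top
-- term `j = suc k` vanishes.
Δ^-expansion : ∀ k h → S (suc k) (λ j → signedC k j * h j) ≈ Δ^ k h 0
Δ^-expansion zero h = solve 1 (λ x → con ℤ.0ℤ :+ con ℤ.1ℤ :* con ℤ.1ℤ :* x := x) R.refl (h 0)
Δ^-expansion (suc k) h = begin
  S (suc (suc k)) (λ j → signedC (suc k) j * h j)
    ≈⟨ S-front (suc k) _ ⟩
  signedC (suc k) 0 * h 0 + S (suc k) (λ j → signedC (suc k) (suc j) * h (suc j))
    ≈⟨ R.+-congˡ (S-cong (suc k) λ where
         j (ℕ.s≤s j≤k) → R.trans (R.*-congʳ (signedC-pascal k j j≤k))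
           (solve 3 (λ a b h → (a :- b) :* h := a :* h :+ :- con ℤ.1ℤ :* (b :* h))
             R.refl (signedC k j) (signedC k (suc j)) (h (suc j)))) ⟩
  signedC (suc k) 0 * h 0 + S (suc k) (λ j → signedC k j * h (suc j) + - 1ℝ * (signedC k (suc j) * h (suc j)))
    ≈⟨ R.+-congˡ (R.trans (S-+ (suc k) _ _) (R.+-congˡ (S-* (suc k) (- 1ℝ) _))) ⟩
  signedC (suc k) 0 * h 0 + (S (suc k) (λ j → signedC k j * h (suc j)) + - 1ℝ * S (suc k) (λ j → signedC k (suc j) * h (suc j)))
    ≈⟨ solve 5 (λ c s h a b → c :* (:- con ℤ.1ℤ :* s) :* h :+ (a :+ :- con ℤ.1ℤ :* b) := a :- (c :* s :* h :+ b))
         R.refl (fromℕ 1) ((- 1ℝ) ^ k) (h 0) (S (suc k) λ j → signedC k j * h (suc j))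
         (S (suc k) λ j → signedC k (suc j) * h (suc j)) ⟩
  S (suc k) (λ j → signedC k j * h (suc j)) - (signedC k 0 * h 0 + S (suc k) (λ j → signedC k (suc j) * h (suc j)))
    ≈⟨ R.+-cong (Δ^-expansion k (λ j → h (suc j))) (R.-‿cong (R.sym (S-front (suc k) _))) ⟩
  Δ^ k (λ j → h (suc j)) 0 - (S (suc k) (λ j → signedC k j * h j) + signedC k (suc k) * h (suc k))
    ≈⟨ R.+-cong (R.reflexive (Δ^-shift k h 0))
         (R.-‿cong (R.+-cong (Δ^-expansion k h) (R.trans (R.*-congʳ (signedC-vanishes (ℕ.n<1+n k))) (R.zeroˡ (h (suc k)))))) ⟩
  Δ^ k h 1 - (Δ^ k h 0 + 0ℝ)
    ≈⟨ R.+-congˡ (R.-‿cong (R.+-identityʳ (Δ^ k h 0))) ⟩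
  Δ^ (suc k) h 0 ∎

-- The discrete Leibniz rule: `Δ y` is 1 and the higher differences of `y` vanish, so two terms
-- survive. The shifted argument `suc j` stands for a factor 1 + Δ, the one that makes `ΛΔ-product`
-- telescope.
Δ^-product : ∀ {y : ℕ → ℝ} → (∀ j → y (suc j) ≈ y j + 1ℝ) → ∀ k h j →
  Δ^ (suc k) (λ i → y i * h i) j ≈ y j * Δ^ (suc k) h j + fromℕ (suc k) * Δ^ k h (suc j)
Δ^-product {y} y-step zero h j = R.trans (R.+-congʳ (R.*-congʳ (y-step j)))
  (solve 3 (λ y a b → (y :+ con ℤ.1ℤ) :* a :- y :* b := y :* (a :- b) :+ con ℤ.1ℤ :* a)
    R.refl (y j) (h (suc j)) (h j))
Δ^-product {y} y-step (suc k) h j = begin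
  Δ^ (suc k) (λ i → y i * h i) (suc j) - Δ^ (suc k) (λ i → y i * h i) j
    ≈⟨ R.+-cong (Δ^-product y-step k h (suc j)) (R.-‿cong (Δ^-product y-step k h j)) ⟩
  y (suc j) * Δ^ (suc k) h (suc j) + n * Δ^ k h (suc (suc j)) - (y j * Δ^ (suc k) h j + n * Δ^ k h (suc j))
    ≈⟨ R.+-congʳ (R.+-congʳ (R.*-congʳ (y-step j))) ⟩
  (y j + 1ℝ) * Δ^ (suc k) h (suc j) + n * Δ^ k h (suc (suc j)) - (y j * Δ^ (suc k) h j + n * Δ^ k h (suc j))
    ≈⟨ solve 5 (λ y n a b c →
           (y :+ con ℤ.1ℤ) :* (a :- b) :+ n :* a :- (y :* (b :- c) :+ n :* b)
           := y :* ((a :- b) :- (b :- c)) :+ (con ℤ.1ℤ :+ n) :* (a :- b))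
         R.refl (y j) n (Δ^ k h (suc (suc j))) (Δ^ k h (suc j)) (Δ^ k h j) ⟩
  y j * Δ^ (suc (suc k)) h j + (1ℝ + n) * Δ^ (suc k) h (suc j)
    ≈⟨ R.+-congˡ (R.*-congʳ (fromℕ-suc (suc k))) ⟨
  y j * Δ^ (suc (suc k)) h j + fromℕ (suc (suc k)) * Δ^ (suc k) h (suc j) ∎
  where
  n : ℝ
  n = fromℕ (suc k)

-- The truncated operator log(1+Δ)/Δ and its action on powers.

-- log(1+Δ)/Δ, truncated at order N and evaluated at 0.
Λ : ℕ → (ℕ → ℝ) → ℝ
Λ N h = S N (λ k → weight k * Δ^ k h 0)

Λ-isLinear : ∀ N → IsLinear (Λ N)
Λ-isLinear N = record
  { cong = λ g≈h → S-cong N λ k _ → R.*-congˡ (cong (Δ^-isLinear k 0) g≈h)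
  ; +-homo = λ g h → R.trans
      (S-cong N λ k _ → R.trans (R.*-congˡ (+-homo (Δ^-isLinear k 0) g h)) (R.distribˡ (weight k) _ _))
      (S-+ N _ _)
  ; *-homo = λ a h → R.trans
      (S-cong N λ k _ → R.trans (R.*-congˡ (*-homo (Δ^-isLinear k 0) a h))
        (solve 3 (λ w a x → w :* (a :* x) := a :* (w :* x)) R.refl (weight k) a (Δ^ k h 0)))
      (S-* N a _)
  }

-- log(1+Δ) is a derivation up to the truncation term.
ΛΔ-product : ∀ {y : ℕ → ℝ} → (∀ j → y (suc j) ≈ y j + 1ℝ) → ∀ N h →
  S N (λ k → weight k * Δ^ (suc k) (λ i → y i * h i) 0)
    ≈ y 0 * S N (λ k → weight k * Δ^ (suc k) h 0) + (h 0 - (- 1ℝ) ^ N * Δ^ N h 0)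
ΛΔ-product {y} y-step zero h =
  solve 2 (λ y h → con ℤ.0ℤ := y :* con ℤ.0ℤ :+ (h :- con ℤ.1ℤ :* h)) R.refl (y 0) (h 0)
ΛΔ-product {y} y-step (suc N) h = begin
  S N (λ k → weight k * Δ^ (suc k) (λ i → y i * h i) 0) + weight N * Δ^ (suc N) (λ i → y i * h i) 0
    ≈⟨ R.+-cong (ΛΔ-product y-step N h) (R.*-congˡ (Δ^-product y-step N h 0)) ⟩
  y 0 * L + (h 0 - s * d₀) + s * i * (y 0 * (d₁ - d₀) + n * d₁)
    ≈⟨ solve 8 (λ y L h s i n d₀ d₁ →
           y :* L :+ (h :- s :* d₀) :+ s :* i :* (y :* (d₁ :- d₀) :+ n :* d₁)
           := y :* (L :+ s :* i :* (d₁ :- d₀)) :+ (h :- s :* d₀ :+ n :* i :* (s :* d₁)))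
         R.refl (y 0) L (h 0) s i n d₀ d₁ ⟩
  y 0 * (L + s * i * (d₁ - d₀)) + (h 0 - s * d₀ + n * i * (s * d₁))
    ≈⟨ R.+-congˡ (R.+-congˡ (R.*-congʳ (n*1/n≈1 (suc N)))) ⟩
  y 0 * (L + s * i * (d₁ - d₀)) + (h 0 - s * d₀ + 1ℝ * (s * d₁))
    ≈⟨ R.+-congˡ (solve 4 (λ h s d₀ d₁ →
           h :- s :* d₀ :+ con ℤ.1ℤ :* (s :* d₁) := h :- :- con ℤ.1ℤ :* s :* (d₁ :- d₀))
         R.refl (h 0) s d₀ d₁) ⟩
  y 0 * (L + s * i * (d₁ - d₀)) + (h 0 - - 1ℝ * s * (d₁ - d₀)) ∎
  where
  L s i n d₀ d₁ : ℝ
  L  = S N (λ k → weight k * Δ^ (suc k) h 0)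
  s  = (- 1ℝ) ^ N
  i  = 1/ (suc N)
  n  = fromℕ (suc N)
  d₀ = Δ^ N h 0
  d₁ = Δ^ N h 1

module _ (t : ℝ) where

  node : ℕ → ℝ
  node j = t + fromℕ j

  node-step : ∀ j → node (suc j) ≈ node j + 1ℝ
  node-step j = R.trans (R.+-congˡ (fromℕ-suc j))
    (solve 2 (λ t j → t :+ (con ℤ.1ℤ :+ j) := t :+ j :+ con ℤ.1ℤ) R.refl t (fromℕ j))

  power : ℕ → ℕ → ℝ
  power n j = node j ^ n

  node₀≈t : node 0 ≈ t
  node₀≈t = R.+-identityʳ t

  -- By `Δ^-product` a difference of order `suc k` of the next power reduces to differences of
  -- orders `suc k` and `k` of `power n`, both above its degree. The shift in that rule is why all
  -- `j` are treated at once.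
  Δ^-power-vanishes : ∀ {n k} → n ℕ.< k → ∀ j → Δ^ k (power n) j ≈ 0ℝ
  Δ^-power-vanishes {zero} {suc zero} _ j = R.-‿inverseʳ 1ℝ
  Δ^-power-vanishes {zero} {suc (suc k)} _ j = R.trans
    (R.+-cong (Δ^-power-vanishes {zero} {suc k} ℕ.z<s (suc j))
      (R.-‿cong (Δ^-power-vanishes {zero} {suc k} ℕ.z<s j)))
    (R.-‿inverseʳ 0ℝ)
  Δ^-power-vanishes {suc n} {suc k} (ℕ.s≤s n<k) j = begin
    Δ^ (suc k) (power (suc n)) j
      ≈⟨ Δ^-product node-step k (power n) j ⟩
    node j * Δ^ (suc k) (power n) j + fromℕ (suc k) * Δ^ k (power n) (suc j)
      ≈⟨ R.+-cong (R.*-congˡ (Δ^-power-vanishes (ℕ.m<n⇒m<1+n n<k) j))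
                  (R.*-congˡ (Δ^-power-vanishes n<k (suc j))) ⟩
    node j * 0ℝ + fromℕ (suc k) * 0ℝ
      ≈⟨ solve 2 (λ a b → a :* con ℤ.0ℤ :+ b :* con ℤ.0ℤ := con ℤ.0ℤ) R.refl (node j) (fromℕ (suc k)) ⟩
    0ℝ ∎

  -- On polynomials log(1+Δ) is differentiation. The bound on `N` makes the truncation term of
  -- `ΛΔ-product` vanish.
  ΛΔ-power : ∀ {n N} → n ℕ.< N →
    S N (λ k → weight k * Δ^ (suc k) (power (suc n)) 0) ≈ fromℕ (suc n) * t ^ n
  ΛΔ-power {n} {N} n<N = begin
    S N (λ k → weight k * Δ^ (suc k) (power (suc n)) 0)
      ≈⟨ ΛΔ-product node-step N (power n) ⟩
    node 0 * S N (λ k → weight k * Δ^ (suc k) (power n) 0) + (power n 0 - (- 1ℝ) ^ N * Δ^ N (power n) 0)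
      ≈⟨ R.+-cong (R.*-cong node₀≈t (R.refl {S N (λ k → weight k * Δ^ (suc k) (power n) 0)}))
           (R.+-cong (^.^-congˡ n node₀≈t) (R.-‿cong (R.*-congˡ (Δ^-power-vanishes n<N 0)))) ⟩
    t * S N (λ k → weight k * Δ^ (suc k) (power n) 0) + (t ^ n - (- 1ℝ) ^ N * 0ℝ)
      ≈⟨ R.+-congʳ (t*ΛΔ-power n n<N) ⟩
    fromℕ n * t ^ n + (t ^ n - (- 1ℝ) ^ N * 0ℝ)
      ≈⟨ solve 3 (λ n p s → n :* p :+ (p :- s :* con ℤ.0ℤ) := (con ℤ.1ℤ :+ n) :* p)
           R.refl (fromℕ n) (t ^ n) ((- 1ℝ) ^ N) ⟩
    (1ℝ + fromℕ n) * t ^ n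
      ≈⟨ R.*-congʳ (fromℕ-suc n) ⟨
    fromℕ (suc n) * t ^ n ∎
    where
    -- The extra factor `t` avoids the exponent n - 1 in the derivative of xⁿ, so the formula also
    -- covers `n = 0`.
    t*ΛΔ-power : ∀ n → n ℕ.< N → t * S N (λ k → weight k * Δ^ (suc k) (power n) 0) ≈ fromℕ n * t ^ n
    t*ΛΔ-power zero 0<N = begin
      t * S N (λ k → weight k * Δ^ (suc k) (power 0) 0)
        ≈⟨ R.*-congˡ (S-truncate {N = N} ℕ.z≤n λ k _ →
             R.trans (R.*-congˡ (Δ^-power-vanishes {0} {suc k} ℕ.z<s 0)) (R.zeroʳ (weight k))) ⟩
      t * 0ℝ           ≈⟨ solve 1 (λ t → t :* con ℤ.0ℤ := con ℤ.0ℤ :* con ℤ.1ℤ) R.refl t ⟩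
      fromℕ 0 * t ^ 0  ∎
    t*ΛΔ-power (suc n) 1+n<N = R.trans (R.*-congˡ (ΛΔ-power (ℕ.<-trans (ℕ.n<1+n n) 1+n<N)))
      (solve 3 (λ t n p → t :* (n :* p) := n :* (t :* p)) R.refl t (fromℕ (suc n)) (t ^ n))

-- Binomial and factorial identities.

multiple≈fromℕ* : ∀ n x → multiple R.+-rawMonoid n x ≈ fromℕ n * x
multiple≈fromℕ* zero    x = R.sym (R.zeroˡ x)
multiple≈fromℕ* (suc n) x = begin
  x + multiple R.+-rawMonoid n x            ≈⟨ R.+-congˡ (multiple≈fromℕ* n x) ⟩
  x + fromℕ n * x       ≈⟨ solve 2 (λ n x → x :+ n :* x := (con ℤ.1ℤ :+ n) :* x) R.refl (fromℕ n) x ⟩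
  (1ℝ + fromℕ n) * x    ≈⟨ R.*-congʳ (fromℕ-suc n) ⟨
  fromℕ (suc n) * x     ∎

1^n≈1 : ∀ n → 1ℝ ^ n ≈ 1ℝ
1^n≈1 zero    = R.refl
1^n≈1 (suc n) = R.trans (R.*-identityˡ (1ℝ ^ n)) (1^n≈1 n)

[y+1]^n-y^n : ∀ n y → (y + 1ℝ) ^ n - y ^ n ≈ S n (λ i → fromℕ (n C i) * y ^ i)
[y+1]^n-y^n n y = begin
  (y + 1ℝ) ^ n - y ^ n
    ≈⟨ R.+-congʳ (Binomial.theorem R.commutativeSemiring n y 1ℝ) ⟩
  ∑[ i ≤ n ] term (toℕ i) - y ^ n
    ≈⟨ R.+-congʳ (sum≈S (suc n) term) ⟩
  S n term + term n - y ^ n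
    ≈⟨ R.+-congʳ (R.+-cong (S-cong n λ i _ → term≈ i) (term≈ n)) ⟩
  S n (λ i → fromℕ (n C i) * y ^ i) + fromℕ (n C n) * y ^ n - y ^ n
    ≡⟨ ≡.cong (λ c → S n (λ i → fromℕ (n C i) * y ^ i) + fromℕ c * y ^ n - y ^ n) (nCn≡1 n) ⟩
  S n (λ i → fromℕ (n C i) * y ^ i) + 1ℝ * y ^ n - y ^ n
    ≈⟨ solve 2 (λ s p → s :+ con ℤ.1ℤ :* p :- p := s) R.refl (S n (λ i → fromℕ (n C i) * y ^ i)) (y ^ n) ⟩
  S n (λ i → fromℕ (n C i) * y ^ i) ∎
  where
  term : ℕ → ℝ
  term i = multiple R.+-rawMonoid (n C i) (y ^ i * 1ℝ ^ (n ∸ i))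

  term≈ : ∀ i → term i ≈ fromℕ (n C i) * y ^ i
  term≈ i = R.trans (multiple≈fromℕ* (n C i) (y ^ i * 1ℝ ^ (n ∸ i)))
    (R.*-congˡ (R.trans (R.*-congˡ (1^n≈1 (n ∸ i))) (R.*-identityʳ (y ^ i))))

1/! : ℕ → ℝ
1/! n = 1/ (n !) {{n ℕ.!≢0}}

-- Turns a product of exponential generating functions into a binomial sum. Both sides are inverse
-- to `i ! * (n ∸ i) !`.
1/i!*1/[n-i]! : ∀ {n i} → i ℕ.≤ n → 1/! i * 1/! (n ∸ i) ≈ 1/! n * fromℕ (n C i)
1/i!*1/[n-i]! {n} {i} i≤n = begin
  1/! i * 1/! (n ∸ i)               ≈⟨ 1/-* (i !) ((n ∸ i) !) ⟩
  1/ (i ! ℕ.* (n ∸ i) !)            ≈⟨ 1/-unique (i ! ℕ.* (n ∸ i) !) inverse ⟨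
  1/! n * fromℕ (n C i)             ∎
  where
  instance
    i!≢0 : NonZero (i !)
    i!≢0 = i ℕ.!≢0
    [n-i]!≢0 : NonZero ((n ∸ i) !)
    [n-i]!≢0 = (n ∸ i) ℕ.!≢0
    i![n-i]!≢0 : NonZero (i ! ℕ.* (n ∸ i) !)
    i![n-i]!≢0 = i ℕ.!* (n ∸ i) !≢0

  n!≡ : (n C i) ℕ.* (i ! ℕ.* (n ∸ i) !) ≡ n !
  n!≡ = ≡.trans (≡.cong (ℕ._* (i ! ℕ.* (n ∸ i) !)) (nCk≡n!/k![n-k]! i≤n)) (m/n*n≡m (k![n∸k]!∣n! i≤n))

  inverse : fromℕ (i ! ℕ.* (n ∸ i) !) * (1/! n * fromℕ (n C i)) ≈ 1ℝ
  inverse = begin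
    fromℕ (i ! ℕ.* (n ∸ i) !) * (1/! n * fromℕ (n C i))
      ≈⟨ solve 3 (λ a b c → a :* (b :* c) := c :* a :* b) R.refl
           (fromℕ (i ! ℕ.* (n ∸ i) !)) (1/! n) (fromℕ (n C i)) ⟩
    fromℕ (n C i) * fromℕ (i ! ℕ.* (n ∸ i) !) * 1/! n
      ≈⟨ R.*-congʳ (fromℕ-* (n C i) (i ! ℕ.* (n ∸ i) !)) ⟨
    fromℕ ((n C i) ℕ.* (i ! ℕ.* (n ∸ i) !)) * 1/! n
      ≡⟨ ≡.cong (λ k → fromℕ k * 1/! n) n!≡ ⟩
    fromℕ (n !) * 1/! n
      ≈⟨ n*1/n≈1 (n !) {{n ℕ.!≢0}} ⟩
    1ℝ ∎

1/!-suc : ∀ n → 1/! (suc n) * fromℕ (suc n) ≈ 1/! n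
1/!-suc n = begin
  1/! (suc n) * fromℕ (suc n)
    ≈⟨ R.*-congʳ (1/-* (suc n) (n !) {{_}} {{n ℕ.!≢0}} {{suc n ℕ.!≢0}}) ⟨
  1/ (suc n) * 1/! n * fromℕ (suc n)
    ≈⟨ solve 3 (λ a b c → a :* b :* c := c :* a :* b) R.refl (1/ (suc n)) (1/! n) (fromℕ (suc n)) ⟩
  fromℕ (suc n) * 1/ (suc n) * 1/! n
    ≈⟨ R.*-congʳ (n*1/n≈1 (suc n)) ⟩
  1ℝ * 1/! n
    ≈⟨ R.*-identityˡ (1/! n) ⟩
  1/! n ∎

-- Power series division and the Bernoulli polynomials.

-- The constant terms of `f` and `h` agree because that of `g` is 1. Removing them shows that the
-- tail of `f` times `g` is exactly the numerator on which `_⊘_` recurses.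
⊘-unique : ∀ {f g h : Series} → g 0 ≈ 1ℝ → f ⊛ g ≋ h → f ≋ h ⊘ g
⊘-unique {f} {g} {h} g₀≈1 f⊛g≋h = quotient
  where
  f₀≈h₀ : f 0 ≈ h 0
  f₀≈h₀ = begin
    f 0              ≈⟨ R.*-identityʳ (f 0) ⟨
    f 0 * 1ℝ         ≈⟨ R.*-congˡ g₀≈1 ⟨
    f 0 * g 0        ≈⟨ R.+-identityʳ (f 0 * g 0) ⟨
    f 0 * g 0 + 0ℝ   ≈⟨ f⊛g≋h 0 ⟩
    h 0              ∎

  quotient : f ≋ h ⊘ g
  quotient zero    = f₀≈h₀
  quotient (suc n) = ⊘-unique {λ k → f (suc k)} {g} {λ k → h (suc k) - h 0 * g (suc k)} g₀≈1
    (λ k → begin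
      ((λ k → f (suc k)) ⊛ g) k
        -- By definition `(f ⊛ g) (suc k)` is `f 0 * g (suc k)` plus the convolution of the tail.
        ≈⟨ solve 2 (λ a b → b := a :+ b :- a) R.refl (f 0 * g (suc k)) (((λ k → f (suc k)) ⊛ g) k) ⟩
      (f ⊛ g) (suc k) - f 0 * g (suc k)
        ≈⟨ R.+-cong (f⊛g≋h (suc k)) (R.-‿cong (R.*-congʳ f₀≈h₀)) ⟩
      h (suc k) - h 0 * g (suc k) ∎) n

Λ-power≈B : ∀ t n → Λ (suc n) (power t n) ≈ B n t
Λ-power≈B t n = begin
  Λ (suc n) (power t n)                    ≈⟨ R.*-identityˡ _ ⟨
  1ℝ * Λ (suc n) (power t n)               ≈⟨ R.*-congʳ (n*1/n≈1 (n !) {{n ℕ.!≢0}}) ⟨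
  fromℕ (n !) * 1/! n * Λ (suc n) (power t n) ≈⟨ R.*-assoc (fromℕ (n !)) (1/! n) (Λ (suc n) (power t n)) ⟩
  fromℕ (n !) * b n                        ≈⟨ R.*-congˡ (⊘-unique {b} {g} {exp t} (pointwise⇒≈ λ _ → ≡.refl) b⊛g≋exp n) ⟩
  B n t                                    ∎
  where
  b g : Series
  b n = 1/! n * Λ (suc n) (power t n)
  g n = exp 1ℝ (suc n)

  b⊛g≋exp : b ⊛ g ≋ exp t
  b⊛g≋exp n = begin
    (b ⊛ g) n
      ≈⟨ sum≈S (suc n) (λ i → b i * g (n ∸ i)) ⟩
    S (suc n) (λ i → b i * g (n ∸ i))
      ≈⟨ S-cong (suc n) coefficient ⟩
    S (suc n) (λ i → 1/! (suc n) * fromℕ (suc n C i) * Λ (suc n) (power t i))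
      ≈⟨ S-homo (Λ-isLinear (suc n)) (suc n) (λ i → 1/! (suc n) * fromℕ (suc n C i)) (power t) ⟨
    Λ (suc n) (λ j → S (suc n) (λ i → 1/! (suc n) * fromℕ (suc n C i) * power t i j))
      ≈⟨ cong (Λ-isLinear (suc n)) difference ⟩
    Λ (suc n) (λ j → 1/! (suc n) * Δ (power t (suc n)) j)
      ≈⟨ *-homo (Λ-isLinear (suc n)) (1/! (suc n)) (Δ (power t (suc n))) ⟩
    1/! (suc n) * Λ (suc n) (Δ (power t (suc n)))
      ≈⟨ R.*-congˡ (S-cong (suc n) λ k _ → R.*-congˡ (R.reflexive (Δ^-Δ k (power t (suc n)) 0))) ⟩
    1/! (suc n) * S (suc n) (λ k → weight k * Δ^ (suc k) (power t (suc n)) 0)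
      ≈⟨ R.*-congˡ (ΛΔ-power t (ℕ.n<1+n n)) ⟩
    1/! (suc n) * (fromℕ (suc n) * t ^ n)
      ≈⟨ R.*-assoc (1/! (suc n)) (fromℕ (suc n)) (t ^ n) ⟨
    1/! (suc n) * fromℕ (suc n) * t ^ n
      ≈⟨ R.*-congʳ (1/!-suc n) ⟩
    1/! n * t ^ n
      ≈⟨ R.*-comm (1/! n) (t ^ n) ⟩
    exp t n ∎
    where
    coefficient : ∀ i → i ℕ.< suc n →
      b i * g (n ∸ i) ≈ 1/! (suc n) * fromℕ (suc n C i) * Λ (suc n) (power t i)
    coefficient i (ℕ.s≤s i≤n) = begin
      1/! i * Λ (suc i) (power t i) * (1ℝ ^ suc (n ∸ i) * 1/! (suc (n ∸ i)))
        ≈⟨ R.*-congˡ (R.trans (R.*-congʳ (1^n≈1 (suc (n ∸ i)))) (R.*-identityˡ _)) ⟩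
      1/! i * Λ (suc i) (power t i) * 1/! (suc (n ∸ i))
        ≡⟨ ≡.cong (λ k → 1/! i * Λ (suc i) (power t i) * 1/! k) (ℕ.+-∸-assoc 1 i≤n) ⟨
      1/! i * Λ (suc i) (power t i) * 1/! (suc n ∸ i)
        ≈⟨ solve 3 (λ a b c → a :* b :* c := a :* c :* b) R.refl
             (1/! i) (Λ (suc i) (power t i)) (1/! (suc n ∸ i)) ⟩
      1/! i * 1/! (suc n ∸ i) * Λ (suc i) (power t i)
        ≈⟨ R.*-cong (1/i!*1/[n-i]! (ℕ.m≤n⇒m≤1+n i≤n))
             -- Each order `suc i` is raised to the common order `suc n`, so that the single linear
             -- functional `Λ (suc n)` can be taken out of the sum; the added differences exceed the
             -- degree `i`.
             (R.sym (S-truncate (ℕ.s≤s i≤n) λ k i<k →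
               R.trans (R.*-congˡ (Δ^-power-vanishes t i<k 0)) (R.zeroʳ (weight k)))) ⟩
      1/! (suc n) * fromℕ (suc n C i) * Λ (suc n) (power t i) ∎

    -- The sum stops at `i = n` because `g` omits the constant term of e^z; the binomial theorem
    -- thus yields a difference of powers.
    difference : ∀ j → S (suc n) (λ i → 1/! (suc n) * fromℕ (suc n C i) * power t i j)
                         ≈ 1/! (suc n) * Δ (power t (suc n)) j
    difference j = begin
      S (suc n) (λ i → 1/! (suc n) * fromℕ (suc n C i) * power t i j)
        ≈⟨ S-cong (suc n) (λ i _ → R.*-assoc (1/! (suc n)) (fromℕ (suc n C i)) (power t i j)) ⟩
      S (suc n) (λ i → 1/! (suc n) * (fromℕ (suc n C i) * power t i j))
        ≈⟨ S-* (suc n) (1/! (suc n)) _ ⟩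
      1/! (suc n) * S (suc n) (λ i → fromℕ (suc n C i) * power t i j)
        ≈⟨ R.*-congˡ ([y+1]^n-y^n (suc n) (node t j)) ⟨
      1/! (suc n) * ((node t j + 1ℝ) ^ suc n - node t j ^ suc n)
        ≈⟨ R.*-congˡ (R.+-congʳ (^.^-congˡ (suc n) (node-step t j))) ⟨
      1/! (suc n) * Δ (power t (suc n)) j ∎

-- The Tanny-Dowling polynomials and their integral.

HasIntegral-resp : ∀ {f g α β I J} → (∀ x → g x ≈ f x) → I ≈ J →
  HasIntegral f α β I → HasIntegral g α β J
HasIntegral-resp g≈f I≈J ∫f ε 0<ε =
  let δ , 0<δ , h = ∫f ε 0<ε
  in δ , 0<δ , λ P w≤δ → ≤-trans
       (∣∣-cong (R.+-cong (Sum.sum-cong-≋ R.semiring λ i → R.*-congʳ (g≈f (TaggedPartition.tag P i))) (R.-‿cong (R.sym I≈J))))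
       (h P w≤δ)

fromℕ-^ : ∀ m n → fromℕ m ^ n ≈ fromℕ (m ℕ.^ n)
fromℕ-^ m zero    = R.refl
fromℕ-^ m (suc n) = R.trans (R.*-congˡ (fromℕ-^ m n)) (R.sym (fromℕ-* m (m ℕ.^ n)))

module _ (a : ℝ) (m : ℕ) .{{m≢0 : NonZero m}} (n : ℕ) where

  t : ℝ
  t = (- a) ÷ m

  coeff : ℕ → ℝ
  coeff k = fromℕ m ^ n * Δ^ k (power t n) 0

  -- Factoring out `m` turns the step `m` into the unit step of `Δ`; the starting point becomes
  -- -a/m.
  mj-a≈m*node : ∀ j → fromℕ m * fromℕ j - a ≈ fromℕ m * node t j
  mj-a≈m*node j = begin
    fromℕ m * fromℕ j - a
      ≈⟨ R.+-congˡ (R.*-identityˡ (- a)) ⟨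
    fromℕ m * fromℕ j + 1ℝ * - a
      ≈⟨ R.+-congˡ (R.*-congʳ (n*1/n≈1 m)) ⟨
    fromℕ m * fromℕ j + fromℕ m * 1/ m * - a
      ≈⟨ solve 4 (λ m j i a → m :* j :+ m :* i :* a := m :* (a :* i :+ j)) R.refl
           (fromℕ m) (fromℕ j) (1/ m) (- a) ⟩
    fromℕ m * node t j ∎

  alternatingSum≈coeff : ∀ k → ∑[ j ≤ k ] (fromℕ (k C toℕ j) * (- 1ℝ) ^ (k ∸ toℕ j)
                          * (fromℕ m * fromℕ (toℕ j) - a) ^ n) ≈ coeff k
  alternatingSum≈coeff k = begin
    ∑[ j ≤ k ] (signedC k (toℕ j) * (fromℕ m * fromℕ (toℕ j) - a) ^ n)
      ≈⟨ sum≈S (suc k) (λ j → signedC k j * (fromℕ m * fromℕ j - a) ^ n) ⟩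
    S (suc k) (λ j → signedC k j * (fromℕ m * fromℕ j - a) ^ n)
      ≈⟨ Δ^-expansion k (λ j → (fromℕ m * fromℕ j - a) ^ n) ⟩
    Δ^ k (λ j → (fromℕ m * fromℕ j - a) ^ n) 0
      ≈⟨ cong (Δ^-isLinear k 0) (λ j → R.trans (^.^-congˡ n (mj-a≈m*node j)) (^.^-distrib-* (fromℕ m) (node t j) n)) ⟩
    Δ^ k (λ j → fromℕ m ^ n * power t n j) 0
      ≈⟨ *-homo (Δ^-isLinear k 0) (fromℕ m ^ n) (power t n) ⟩
    coeff k ∎

  -- The factor `m ^ k` produced by the argument `m * x`, together with `k !`, cancels the
  -- denominator of `W̃`.
  F̃-term : ∀ k x → fromℕ (k !) * W̃ m a n k * (fromℕ m * x) ^ k ≈ coeff k * x ^ k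
  F̃-term k x = begin
    fromℕ (k !) * (A * i) * (fromℕ m * x) ^ k
      ≈⟨ R.*-congˡ (R.trans (^.^-distrib-* (fromℕ m) x k) (R.*-congʳ (fromℕ-^ m k))) ⟩
    fromℕ (k !) * (A * i) * (fromℕ (m ℕ.^ k) * x ^ k)
      ≈⟨ solve 5 (λ f A i m x → f :* (A :* i) :* (m :* x) := m :* f :* i :* (A :* x)) R.refl
           (fromℕ (k !)) A i (fromℕ (m ℕ.^ k)) (x ^ k) ⟩
    fromℕ (m ℕ.^ k) * fromℕ (k !) * i * (A * x ^ k)
      ≈⟨ R.*-congʳ (R.trans (R.*-congʳ (R.sym (fromℕ-* (m ℕ.^ k) (k !)))) (n*1/n≈1 (m ℕ.^ k ℕ.* k !))) ⟩
    1ℝ * (A * x ^ k)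
      ≈⟨ R.*-identityˡ (A * x ^ k) ⟩
    A * x ^ k
      ≈⟨ R.*-congʳ (alternatingSum≈coeff k) ⟩
    coeff k * x ^ k ∎
    where
    instance
      m^k*k!≢0 : NonZero (m ℕ.^ k ℕ.* k !)
      m^k*k!≢0 = ℕ.m*n≢0 (m ℕ.^ k) (k !) {{ℕ.m^n≢0 m k}} {{k ℕ.!≢0}}

    A i : ℝ
    A = ∑[ j ≤ k ] (fromℕ (k C toℕ j) * (- 1ℝ) ^ (k ∸ toℕ j) * (fromℕ m * fromℕ (toℕ j) - a) ^ n)
    i = 1/ (m ℕ.^ k ℕ.* k !)

  F̃≈polynomial : ∀ x → F̃ m a n (fromℕ m * x) ≈ S (suc n) (λ k → coeff k * x ^ k)
  F̃≈polynomial x = R.trans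
    (sum≈S (suc n) (λ k → fromℕ (k !) * W̃ m a n k * (fromℕ m * x) ^ k))
    (S-cong (suc n) λ k _ → F̃-term k x)

  weightedSum≈B : S (suc n) (λ k → coeff k * weight k) ≈ fromℕ m ^ n * B n t
  weightedSum≈B = begin
    S (suc n) (λ k → coeff k * weight k)
      ≈⟨ S-cong (suc n) (λ k _ → solve 3 (λ m d w → m :* d :* w := m :* (w :* d)) R.refl
           (fromℕ m ^ n) (Δ^ k (power t n) 0) (weight k)) ⟩
    S (suc n) (λ k → fromℕ m ^ n * (weight k * Δ^ k (power t n) 0))
      ≈⟨ S-* (suc n) (fromℕ m ^ n) _ ⟩
    fromℕ m ^ n * Λ (suc n) (power t n)
      ≈⟨ R.*-congˡ (Λ-power≈B t n) ⟩
    fromℕ m ^ n * B n t ∎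

theorem1 : ∀ (a : ℝ) (m : ℕ) .{{_ : NonZero m}} (n : ℕ) →
    HasIntegral (λ x → F̃ m a n (fromℕ m * x)) (- 1ℝ) 0ℝ
    (fromℕ m ^ n * B n ((- a) ÷ m))
theorem1 a m n = HasIntegral-resp (F̃≈polynomial a m n) (weightedSum≈B a m n)
  (∫-polynomial (coeff a m n) (suc n))
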